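{- Let $2\le q<p$ be constants. There is a (sufficiently small) constant $c>0$ such that the following holds: if a randomized algorithm solves the $\ell_p$ regression problem up to a relative error of $c\,d^{\frac12\left(1-\frac qp\right)}$, i.e., given any $A\in\mathbb R^{n\times d}$ and query access to any $b\in\mathbb R^n$ it outputs $\tilde x$ with $$\|A\tilde x-b\|_p\le c\,d^{\frac12\left(1-\frac qp\right)}\min_{x\in\mathbb R^d}\|Ax-b\|_p$$ with probability at least $0.99$, and it queries $m$ entries of $b$ in expectation, then $m=\Omega(d^{q/2})$.
   Context: Active regression: the design matrix $A$ is fully known to the algorithm, while each entry of $b$ read counts as one query. The lower bound is worst case over instances with $d$ columns ($n$ may depend on $d$, $p$, $q$); $m$ is the worst-case expected number of queries. The constant in $\Omega(\cdot)$ may depend on $p$ and $q$. -}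

module Defs where

open import Level using (0ℓ)
open import Algebra.Bundles using (CommutativeRing)
import Algebra.Construct.NaturalChoice.Max as Max
import Algebra.Properties.Monoid.Mult as Mult
import Algebra.Properties.Monoid.Sum as Sum
open import Data.Fin.Base using (Fin; toℕ)
open import Data.Nat.Base using (ℕ; zero; suc)
open import Data.Product using (∃; _×_)
open import Data.Vec.Functional using (Vector)
open import Relation.Binary.Bundles using (TotalOrder)
open import Relation.Binary.Core using (Rel)
import Relation.Binary.Construct.NonStrictToStrict as Strict
open import Relation.Binary.PropositionalEquality using (_≡_; _≢_)
open import Relation.Binary.Structures using (IsTotalOrder)
open import Relation.Nullary using (¬_)
open import Relation.Unary using (Pred; Satisfiable; U; ∅; ∁; ⋃; _≐_; _⊆_; _⊥_)

-- The library has no real numbers.  They are taken axiomatically, as a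
-- Dedekind-complete ordered field; classically there is exactly one up to
-- isomorphism.
record CompleteOrderedField : Set₁ where
  infix  4 _≤_
  infix  8 _⁻¹
  field
    commutativeRing : CommutativeRing 0ℓ 0ℓ

  open CommutativeRing commutativeRing public renaming (zero to *-zero)

  -- x ⁻¹ is unspecified for x ≈ 0#.
  field
    _≤_          : Rel Carrier 0ℓ
    isTotalOrder : IsTotalOrder _≈_ _≤_
    +-monoˡ-≤    : ∀ {x y} z → x ≤ y → x + z ≤ y + z
    *-nonNeg     : ∀ {x y} → 0# ≤ x → 0# ≤ y → 0# ≤ x * y
    0≉1          : ¬ 0# ≈ 1#
    _⁻¹          : Carrier → Carrier
    *-inverseʳ   : ∀ {x} → ¬ x ≈ 0# → x * x ⁻¹ ≈ 1#

  UpperBound : Pred Carrier 0ℓ → Pred Carrier 0ℓ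
  UpperBound P u = ∀ x → P x → x ≤ u

  IsSupremum : Pred Carrier 0ℓ → Pred Carrier 0ℓ
  IsSupremum P s = UpperBound P s × (∀ u → UpperBound P u → s ≤ u)

  field
    complete : ∀ P → Satisfiable P → Satisfiable (UpperBound P) →
               ∃ (IsSupremum P)

  totalOrder : TotalOrder 0ℓ 0ℓ 0ℓ
  totalOrder = record { isTotalOrder = isTotalOrder }

  open Strict _≈_ _≤_ public using (_<_)
  open Max totalOrder public using (_⊔_)
  open Sum +-monoid public using (sum)
  open Mult +-monoid using () renaming (_×_ to _×ᴿ_)

  infixl 7 _/_
  _/_ : Carrier → Carrier → Carrier
  x / y = x * y ⁻¹

  ∣_∣ : Carrier → Carrier
  ∣ x ∣ = x ⊔ - x

  fromℕ : ℕ → Carrier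
  fromℕ n = n ×ᴿ 1#

  IsMinimum : {X : Set} → (X → Carrier) → Pred Carrier 0ℓ
  IsMinimum f μ = (∃ λ x → f x ≈ μ) × (∀ x → μ ≤ f x)

  -- Convergence of a series with nonnegative terms.
  IsSeriesSum : (ℕ → Carrier) → Pred Carrier 0ℓ
  IsSeriesSum t = IsSupremum λ s → ∃ λ K → s ≈ sum {K} (λ k → t (toℕ k))

-- Real powers of nonnegative reals.  On positive bases the laws determine _^_
-- uniquely: they fix x ^ r for rational r, and monotonicity in the exponent
-- extends this to real r.  Powers of negative reals, and 0# ^ a for a ≤ 0#,
-- are unspecified.
record RealPower (ℝ : CompleteOrderedField) : Set where
  open CompleteOrderedField ℝ
  infixr 8 _^_
  field
    _^_       : Carrier → Carrier → Carrier
    ^-cong    : ∀ {x y a b} → x ≈ y → a ≈ b → x ^ a ≈ y ^ b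
    ^-pos     : ∀ {x} a → 0# < x → 0# < x ^ a
    ^-zeroˡ   : ∀ {a} → 0# < a → 0# ^ a ≈ 0#
    ^-identʳ  : ∀ {x} → 0# < x → x ^ 1# ≈ x
    ^-distribˡ-+ : ∀ {x} a b → 0# < x → x ^ (a + b) ≈ x ^ a * x ^ b
    ^-distribʳ-* : ∀ {x y} a → 0# < x → 0# < y → (x * y) ^ a ≈ x ^ a * y ^ a
    ^-assocʳ  : ∀ {x} a b → 0# < x → (x ^ a) ^ b ≈ x ^ (a * b)
    ^-monoʳ-≤ : ∀ {x a b} → 1# ≤ x → a ≤ b → x ^ a ≤ x ^ b

module Regression (ℝ : CompleteOrderedField) (power : RealPower ℝ) where
  open CompleteOrderedField ℝ public
  open RealPower power public

  -- ℙ is total, but constrained on measurable sets only.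
  record ProbabilitySpace : Set₁ where
    field
      Ω            : Set
      Measurable   : Pred (Pred Ω 0ℓ) 0ℓ
      measurable-≐ : ∀ {E F} → E ≐ F → Measurable E → Measurable F
      measurable-U : Measurable U
      measurable-∁ : ∀ {E} → Measurable E → Measurable (∁ E)
      measurable-⋃ : ∀ (E : ℕ → Pred Ω 0ℓ) → (∀ k → Measurable (E k)) →
                     Measurable (⋃ ℕ E)
      ℙ            : Pred Ω 0ℓ → Carrier
      ℙ-≐          : ∀ {E F} → Measurable E → E ≐ F → ℙ E ≈ ℙ F
      ℙ-nonNeg     : ∀ {E} → Measurable E → 0# ≤ ℙ E
      ℙ-∅          : ℙ ∅ ≈ 0#
      ℙ-U          : ℙ U ≈ 1#
      ℙ-⋃          : ∀ (E : ℕ → Pred Ω 0ℓ) → (∀ k → Measurable (E k)) →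
                     (∀ {j k} → j ≢ k → E j ⊥ E k) →
                     IsSeriesSum (λ k → ℙ (E k)) (ℙ (⋃ ℕ E))

    -- For measurable S this says t ≤ ℙ S.
    HasProbabilityAtLeast : Carrier → Pred Ω 0ℓ → Set₁
    HasProbabilityAtLeast t S = ∃ λ E → Measurable E × E ⊆ S × t ≤ ℙ E

    IsExpectation : (Ω → ℕ) → Pred Carrier 0ℓ
    IsExpectation N = IsSeriesSum λ k → fromℕ k * ℙ (λ ω → N ω ≡ k)

  Matrix : ℕ → ℕ → Set
  Matrix n d = Vector (Vector Carrier d) n

  infixr 7 _·_
  _·_ : ∀ {n d} → Matrix n d → Vector Carrier d → Vector Carrier n
  (A · x) i = sum λ j → A i j * x j

  ‖_‖[_] : ∀ {n} → Vector Carrier n → Carrier → Carrier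
  ‖ v ‖[ p ] = (sum λ i → ∣ v i ∣ ^ p) ^ (1# / p)

  cost : ∀ {n d} → Carrier → Matrix n d → Vector Carrier n →
         Vector Carrier d → Carrier
  cost p A b x = ‖ (λ i → (A · x) i - b i) ‖[ p ]

  IsApproxSolution : ∀ {n d} → Carrier → Carrier → Matrix n d →
                     Vector Carrier n → Vector Carrier d → Set
  IsApproxSolution p ρ A b x̃ =
    ∃ λ μ → IsMinimum (cost p A b) μ × cost p A b x̃ ≤ ρ * μ

  -- A deterministic adaptive procedure reading entries of b ∈ ℝⁿ: the next
  -- position, and finally the output, may depend on all answers so far.
  data QueryTree (n d : ℕ) : Set where
    output : Vector Carrier d → QueryTree n d
    query  : Fin n → (Carrier → QueryTree n d) → QueryTree n d

  result : ∀ {n d} → QueryTree n d → Vector Carrier n → Vector Carrier d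
  result (output x)  b = x
  result (query i k) b = result (k (b i)) b

  queries : ∀ {n d} → QueryTree n d → Vector Carrier n → ℕ
  queries (output x)  b = zero
  queries (query i k) b = suc (queries (k (b i)) b)

  record RandomizedQueryTree (n d : ℕ) : Set₁ where
    field
      space : ProbabilitySpace
    open ProbabilitySpace space public
    field
      tree : Ω → QueryTree n d
      queries-measurable : ∀ b k → Measurable (λ ω → queries (tree ω) b ≡ k)

  -- The matrix is known: the whole randomized procedure, including its source
  -- of randomness, may depend on it.
  RandomizedAlgorithm : ℕ → Set₁
  RandomizedAlgorithm d = ∀ {n} → Matrix n d → RandomizedQueryTree n d

  SolvesRegression : ∀ {d} → Carrier → Carrier → RandomizedAlgorithm d → Set₁
  SolvesRegression {d} p ρ alg = ∀ {n} (A : Matrix n d) (b : Vector Carrier n) →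
    let open RandomizedQueryTree (alg A) in
    HasProbabilityAtLeast (fromℕ 99 / fromℕ 100)
      (λ ω → IsApproxSolution p ρ A b (result (tree ω) b))

  ExpectedQueriesAtMost : ∀ {d} → Carrier → RandomizedAlgorithm d → Set
  ExpectedQueriesAtMost {d} m alg =
    ∀ {n} (A : Matrix n d) (b : Vector Carrier n) →
    let open RandomizedQueryTree (alg A) in
    ∃ λ e → IsExpectation (λ ω → queries (tree ω) b) e × e ≤ m

{-# OPTIONS --safe #-}
module Submission where

-- There are n ≈ d^(q/2) sign vectors aᵢ ∈ {±1}ᵈ with Σ_{j≠i} |⟨aᵢ,aⱼ⟩|ᵖ ≤ B n d^(p/2)
-- for each i, as if they were random.  Take them as the rows of A.  On b = 0 a
-- correct output x̃ satisfies A x̃ = 0.  On b = d eᵢ such an output costs at least d,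
-- whereas x = aᵢ costs at most (B n d^(p/2))^(1/p) ≤ B^(1/p) d^(1/2 + q/(2p)), so for
-- small c it is not admissible.  Runs on the two inputs agree until entry i is read;
-- hence on b = 0 each of the n entries is read with probability at least 0.98, and
-- the expected number of queries is of order n.
--
-- The vectors come from repeatedly adjoining to a multiplicative group of sign vectors
-- a new generator g, which is found by derandomising the bound E⟨a,g⟩^(2K) ≤ (ℓ d)ᴷ.

open import Defs
open import Level using (0ℓ)
open import Axiom.ExcludedMiddle using (ExcludedMiddle)
open import Data.Nat.Base using (ℕ; NonZero)
open import Data.Product using (∃; _×_)
open import Algebra.Bundles using (RawRing)
import Algebra.Construct.NaturalChoice.Max
import Algebra.Construct.NaturalChoice.MaxOp
import Algebra.Properties.AbelianGroup
import Algebra.Properties.CommutativeSemiring.Exp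
import Algebra.Properties.Ring
import Algebra.Properties.Semiring.Mult
import Algebra.Properties.Semiring.Sum
import Algebra.Solver.Ring
open import Algebra.Solver.Ring.AlmostCommutativeRing using (fromCommutativeRing; _-Raw-AlmostCommutative⟶_; Induced-equivalence)
open import Data.Bool.Base using (if_then_else_)
open import Data.Empty using (⊥-elim)
open import Data.Fin.Base as Fin using (Fin; zero; suc; toℕ)
import Data.Fin.Properties as Fin
open import Data.Maybe.Base using (just; nothing)
open import Data.Nat.Base as ℕ using (zero; suc)
import Data.Nat.Properties as ℕ
open import Data.Product using (_,_; proj₁; proj₂)
open import Data.Product.Properties using (≡-dec)
open import Data.Sum.Base using (_⊎_; inj₁; inj₂; [_,_]′)
open import Data.Vec.Functional using (Vector; _++_; _∷_; tail)
open import Function.Base using (_∘_)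
open import Relation.Binary.Bundles using (Poset)
open import Relation.Binary.Core using (_Preserves_⟶_)
open import Relation.Binary.Definitions using (WeaklyDecidable)
import Relation.Binary.Properties.TotalOrder
open import Relation.Binary.PropositionalEquality as ≡ using (_≡_; _≢_)
import Relation.Binary.Reasoning.PartialOrder
import Relation.Binary.Reasoning.Setoid
open import Relation.Binary.Structures using (IsTotalOrder)
open import Relation.Nullary using (¬_; yes; no; does; contradiction)
open import Relation.Unary using (Pred; U; ∅; ∁; ⋃; _≐_; _⊆_; _⊥_; _∪_; _∩_)

-- The residual bound is needed for every row separately, whereas a balanced choice of signs
-- controls one sum over all rows. The group structure closes this gap: row `i` sees the same inner
-- products as the all-ones vector, so a single moment has to be tracked. Rows may repeat; all sums
-- count them with multiplicity.
--
-- The real exponent `p` enters only through |x|^p ≤ D^(p/2) (1 + (x²/D)^K) with an integer K ≥ p/2,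
-- so that the search for signs deals with polynomials. The size d^(q/2) is dictated by the error
-- factor: d^((1 - q/p)/2) times (n d^(p/2))^(1/p) has order d exactly when n has order d^(q/2).
--
-- The event that an entry is read comes without measurability, and the expectation is a supremum of
-- partial sums. The former is therefore replaced by the intersection of two success events, and
-- runs with too many queries are cut off, which lowers the constant 0.98 to 0.97.

-- Ordered field arithmetic, finite sums and absolute values

module OrderedField (em : ExcludedMiddle 0ℓ) (ℝ : CompleteOrderedField) where
  open CompleteOrderedField ℝ public
  open IsTotalOrder isTotalOrder public using (total; isPartialOrder)
    renaming (refl to ≤-refl; trans to ≤-trans; reflexive to ≤-reflexive; antisym to ≤-antisym)
  open Algebra.Properties.AbelianGroup +-abelianGroup public using ()
    renaming (ε⁻¹≈ε to -0≈0; ⁻¹-involutive to -‿involutive; ⁻¹-∙-comm to -‿+-comm)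
  open Algebra.Properties.Ring ring public
    using (-‿distribʳ-*; x[y-z]≈xy-xz; [y-z]x≈yx-zx)
  open Algebra.Properties.CommutativeSemiring.Exp commutativeSemiring public using ()
    renaming (_^_ to _^ⁿ_; ^-congˡ to ^ⁿ-congˡ; ^-distrib-* to ^ⁿ-distrib-*)
  open Algebra.Properties.Semiring.Mult semiring public using (×-homo-+; ×1-homo-*)
  open Algebra.Properties.Semiring.Sum semiring public
    using (sum-cong-≋; sum-init-last; ∑-distrib-+; *-distribˡ-sum; *-distribʳ-sum)

  open Algebra.Construct.NaturalChoice.MaxOp (Algebra.Construct.NaturalChoice.Max.maxOperator totalOrder) public
    using (⊔-sel; x≤x⊔y; x≤y⊔x)
  open Relation.Binary.Properties.TotalOrder totalOrder public
    using (≰⇒>; <⇒≱)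

  poset : Poset 0ℓ 0ℓ 0ℓ
  poset = record { isPartialOrder = isPartialOrder }

  module ≤-Reasoning = Relation.Binary.Reasoning.PartialOrder poset
  module ≈-Reasoning = Relation.Binary.Reasoning.Setoid setoid

  -- Coefficients of the ring solver: (m , n) stands for the integer m - n, and
  -- normalisation makes one of m and n vanish.
  private
    normalise : ℕ → ℕ → ℕ × ℕ
    normalise (suc m) (suc n) = normalise m n
    normalise m       n       = m , n

    Coeff : RawRing 0ℓ 0ℓ
    Coeff = record
      { Carrier = ℕ × ℕ
      ; _≈_ = _≡_
      ; _+_ = λ { (a , b) (c , d) → normalise (a ℕ.+ c) (b ℕ.+ d) }
      ; _*_ = λ { (a , b) (c , d) → normalise (a ℕ.* c ℕ.+ b ℕ.* d) (a ℕ.* d ℕ.+ b ℕ.* c) }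
      ; -_ = λ { (a , b) → b , a }
      ; 0# = 0 , 0
      ; 1# = 1 , 0
      }

    -- The clauses are chosen so that `(1 , 0)` denotes `1#` itself rather than `1# + 0#`, and
    -- `(m , 0)` denotes `fromℕ m` without a subtraction; constants then match the goals literally.
    ⟦_⟧ᶜ : ℕ × ℕ → Carrier
    ⟦ m , suc n ⟧ᶜ = fromℕ m - fromℕ (suc n)
    ⟦ 1 , 0 ⟧ᶜ     = 1#
    ⟦ m , 0 ⟧ᶜ     = fromℕ m

    x-0≈x : ∀ x → x - 0# ≈ x
    x-0≈x x = trans (+-congˡ -0≈0) (+-identityʳ x)

    ⟦⟧ᶜ-difference : ∀ m n → ⟦ m , n ⟧ᶜ ≈ fromℕ m - fromℕ n
    ⟦⟧ᶜ-difference zero          zero    = sym (x-0≈x _)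
    ⟦⟧ᶜ-difference (suc zero)    zero    = sym (trans (x-0≈x _) (+-identityʳ 1#))
    ⟦⟧ᶜ-difference (suc (suc m)) zero    = sym (x-0≈x _)
    ⟦⟧ᶜ-difference m             (suc n) = refl

    -- This and the next two identities are ingredients of the solver's own homomorphism laws, hence
    -- the proofs by hand.
    interchange : ∀ w x y z → (w + x) + (y + z) ≈ (w + y) + (x + z)
    interchange w x y z = begin
      (w + x) + (y + z)  ≈⟨ +-assoc w x _ ⟩
      w + (x + (y + z))  ≈⟨ +-congˡ (+-assoc x y z) ⟨
      w + (x + y + z)    ≈⟨ +-congˡ (+-congʳ (+-comm x y)) ⟩
      w + (y + x + z)    ≈⟨ +-congˡ (+-assoc y x z) ⟩
      w + (y + (x + z))  ≈⟨ +-assoc w y _ ⟨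
      (w + y) + (x + z)  ∎
      where open ≈-Reasoning

    +-homo : ∀ x y x′ y′ → (x + x′) - (y + y′) ≈ (x - y) + (x′ - y′)
    +-homo x y x′ y′ = trans (+-congˡ (sym (-‿+-comm y y′))) (interchange x x′ (- y) (- y′))

    *-homo : ∀ x y x′ y′ → (x * x′ + y * y′) - (x * y′ + y * x′) ≈ (x - y) * (x′ - y′)
    *-homo x y x′ y′ = begin
      (x * x′ + y * y′) - (x * y′ + y * x′)      ≈⟨ +-homo _ _ _ _ ⟩
      (x * x′ - x * y′) + (y * y′ - y * x′)      ≈⟨ +-cong (x[y-z]≈xy-xz x x′ y′) (x[y-z]≈xy-xz y y′ x′) ⟨
      x * (x′ - y′) + y * (y′ - x′)              ≈⟨ +-congˡ (*-congˡ swap) ⟩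
      x * (x′ - y′) + y * - (x′ - y′)            ≈⟨ +-congˡ (-‿distribʳ-* y _) ⟨
      x * (x′ - y′) - y * (x′ - y′)              ≈⟨ [y-z]x≈yx-zx (x′ - y′) x y ⟨
      (x - y) * (x′ - y′)                        ∎
      where
      open ≈-Reasoning
      swap : y′ - x′ ≈ - (x′ - y′)
      swap = begin
        y′ - x′          ≈⟨ +-congʳ (-‿involutive y′) ⟨
        - - y′ - x′      ≈⟨ +-comm _ _ ⟩
        - x′ - - y′      ≈⟨ -‿+-comm x′ (- y′) ⟩
        - (x′ - y′)      ∎

    ⟦normalise⟧ : ∀ m n → ⟦ normalise m n ⟧ᶜ ≈ fromℕ m - fromℕ n
    ⟦normalise⟧ (suc m) (suc n) = begin
      ⟦ normalise m n ⟧ᶜ                 ≈⟨ ⟦normalise⟧ m n ⟩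
      fromℕ m - fromℕ n                  ≈⟨ +-identityˡ _ ⟨
      0# + (fromℕ m - fromℕ n)           ≈⟨ +-congʳ (-‿inverseʳ 1#) ⟨
      (1# - 1#) + (fromℕ m - fromℕ n)    ≈⟨ +-homo 1# 1# _ _ ⟨
      fromℕ (suc m) - fromℕ (suc n)      ∎
      where open ≈-Reasoning
    ⟦normalise⟧ (suc m) zero    = ⟦⟧ᶜ-difference (suc m) zero
    ⟦normalise⟧ zero    n       = ⟦⟧ᶜ-difference zero n

    fromCoeff : Coeff -Raw-AlmostCommutative⟶ fromCommutativeRing commutativeRing
    fromCoeff = record
      { ⟦_⟧ = ⟦_⟧ᶜ
      ; +-homo = λ { (a , b) (c , d) →
          trans (⟦normalise⟧ (a ℕ.+ c) (b ℕ.+ d))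
            (trans (+-cong (×-homo-+ 1# a c) (-‿cong (×-homo-+ 1# b d)))
              (trans (+-homo _ _ _ _) (sym (+-cong (⟦⟧ᶜ-difference a b) (⟦⟧ᶜ-difference c d))))) }
      ; *-homo = λ { (a , b) (c , d) → trans (⟦normalise⟧ (a ℕ.* c ℕ.+ b ℕ.* d) (a ℕ.* d ℕ.+ b ℕ.* c)) (trans
          (+-cong (trans (×-homo-+ 1# (a ℕ.* c) (b ℕ.* d)) (+-cong (×1-homo-* a c) (×1-homo-* b d)))
            (-‿cong (trans (×-homo-+ 1# (a ℕ.* d) (b ℕ.* c)) (+-cong (×1-homo-* a d) (×1-homo-* b c)))))
          (trans (*-homo _ _ _ _) (sym (*-cong (⟦⟧ᶜ-difference a b) (⟦⟧ᶜ-difference c d))))) }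
      ; -‿homo = λ { (a , b) → begin
          ⟦ b , a ⟧ᶜ               ≈⟨ ⟦⟧ᶜ-difference b a ⟩
          fromℕ b - fromℕ a        ≈⟨ +-comm _ _ ⟩
          - fromℕ a + fromℕ b      ≈⟨ +-congˡ (-‿involutive _) ⟨
          - fromℕ a - - fromℕ b    ≈⟨ -‿+-comm _ _ ⟩
          - (fromℕ a - fromℕ b)    ≈⟨ -‿cong (⟦⟧ᶜ-difference a b) ⟨
          - ⟦ a , b ⟧ᶜ             ∎ }
      ; 0-homo = refl
      ; 1-homo = refl
      }
      where open ≈-Reasoning

    coeff≟ : WeaklyDecidable (Induced-equivalence fromCoeff)
    coeff≟ x y with ≡-dec ℕ._≟_ ℕ._≟_ x y
    ... | yes ≡.refl = just refl
    ... | no _       = nothing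

  open Algebra.Solver.Ring Coeff (fromCommutativeRing commutativeRing) fromCoeff coeff≟ public
    using (solve; con; _:+_; _:*_; _:-_; :-_; _:=_)

  +-monoʳ-≤ : ∀ z {x y} → x ≤ y → z + x ≤ z + y
  +-monoʳ-≤ z {x} {y} x≤y = begin
    z + x  ≈⟨ +-comm z x ⟩
    x + z  ≤⟨ +-monoˡ-≤ z x≤y ⟩
    y + z  ≈⟨ +-comm y z ⟩
    z + y  ∎
    where open ≤-Reasoning

  +-mono-≤ : ∀ {w x y z} → w ≤ x → y ≤ z → w + y ≤ x + z
  +-mono-≤ w≤x y≤z = ≤-trans (+-monoˡ-≤ _ w≤x) (+-monoʳ-≤ _ y≤z)

  +-nonNeg : ∀ {x y} → 0# ≤ x → 0# ≤ y → 0# ≤ x + y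
  +-nonNeg 0≤x 0≤y = ≤-trans (≤-reflexive (sym (+-identityʳ 0#))) (+-mono-≤ 0≤x 0≤y)

  x≤x+y : ∀ {x y} → 0# ≤ y → x ≤ x + y
  x≤x+y {x} 0≤y = ≤-trans (≤-reflexive (sym (+-identityʳ x))) (+-monoʳ-≤ x 0≤y)

  x≤y+x : ∀ {x y} → 0# ≤ y → x ≤ y + x
  x≤y+x {x} 0≤y = ≤-trans (≤-reflexive (sym (+-identityˡ x))) (+-monoˡ-≤ x 0≤y)

  +-cancelʳ-≤ : ∀ {x y} z → x + z ≤ y + z → x ≤ y
  +-cancelʳ-≤ {x} {y} z x+z≤y+z = begin
    x          ≈⟨ solve 2 (λ x z → x := x :+ z :- z) refl x z ⟩
    x + z - z  ≤⟨ +-monoˡ-≤ (- z) x+z≤y+z ⟩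
    y + z - z  ≈⟨ solve 2 (λ y z → y :+ z :- z := y) refl y z ⟩
    y          ∎
    where open ≤-Reasoning

  x≤y⇒0≤y-x : ∀ {x y} → x ≤ y → 0# ≤ y - x
  x≤y⇒0≤y-x {x} x≤y = ≤-trans (≤-reflexive (sym (-‿inverseʳ x))) (+-monoˡ-≤ (- x) x≤y)

  0≤y-x⇒x≤y : ∀ {x y} → 0# ≤ y - x → x ≤ y
  0≤y-x⇒x≤y {x} {y} 0≤y-x = begin
    x            ≤⟨ x≤y+x 0≤y-x ⟩
    y - x + x    ≈⟨ solve 2 (λ x y → y :- x :+ x := y) refl x y ⟩
    y            ∎
    where open ≤-Reasoning

  neg-nonNeg : ∀ {x} → x ≤ 0# → 0# ≤ - x
  neg-nonNeg x≤0 = ≤-trans (x≤y⇒0≤y-x x≤0) (≤-reflexive (+-identityˡ _))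

  *-monoʳ-≤ : ∀ {x y z} → 0# ≤ z → x ≤ y → z * x ≤ z * y
  *-monoʳ-≤ {x} {y} {z} 0≤z x≤y = 0≤y-x⇒x≤y
    (≤-trans (*-nonNeg 0≤z (x≤y⇒0≤y-x x≤y)) (≤-reflexive (x[y-z]≈xy-xz z y x)))

  *-monoˡ-≤ : ∀ {x y z} → 0# ≤ z → x ≤ y → x * z ≤ y * z
  *-monoˡ-≤ {x} {y} {z} 0≤z x≤y = begin
    x * z  ≈⟨ *-comm x z ⟩
    z * x  ≤⟨ *-monoʳ-≤ 0≤z x≤y ⟩
    z * y  ≈⟨ *-comm z y ⟩
    y * z  ∎
    where open ≤-Reasoning

  *-mono-≤ : ∀ {w x y z} → 0# ≤ x → 0# ≤ y → w ≤ x → y ≤ z → w * y ≤ x * z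
  *-mono-≤ 0≤x 0≤y w≤x y≤z = ≤-trans (*-monoˡ-≤ 0≤y w≤x) (*-monoʳ-≤ 0≤x y≤z)

  square-nonNeg : ∀ x → 0# ≤ x * x
  square-nonNeg x with total 0# x
  ... | inj₁ 0≤x = *-nonNeg 0≤x 0≤x
  ... | inj₂ x≤0 = ≤-trans (*-nonNeg (neg-nonNeg x≤0) (neg-nonNeg x≤0))
    (≤-reflexive (solve 1 (λ x → :- x :* :- x := x :* x) refl x))

  0≤1 : 0# ≤ 1#
  0≤1 = ≤-trans (square-nonNeg 1#) (≤-reflexive (*-identityʳ 1#))

  0<1 : 0# < 1#
  0<1 = 0≤1 , 0≉1

  <-≤-trans : ∀ {x y z} → x < y → y ≤ z → x < z
  <-≤-trans {x} x<y y≤z = ≤-trans (proj₁ x<y) y≤z ,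
    λ x≈z → <⇒≱ x<y (≤-trans y≤z (≤-reflexive (sym x≈z)))

  fromℕ-nonNeg : ∀ n → 0# ≤ fromℕ n
  fromℕ-nonNeg zero    = ≤-refl
  fromℕ-nonNeg (suc n) = +-nonNeg 0≤1 (fromℕ-nonNeg n)

  fromℕ-pos : ∀ n .{{_ : NonZero n}} → 0# < fromℕ n
  fromℕ-pos (suc n) = <-≤-trans 0<1 (x≤x+y (fromℕ-nonNeg n))

  fromℕ-mono-≤ : ∀ {m n} → m ℕ.≤ n → fromℕ m ≤ fromℕ n
  fromℕ-mono-≤ {n = n} ℕ.z≤n = fromℕ-nonNeg n
  fromℕ-mono-≤ (ℕ.s≤s {m} {n} m≤n) = +-monoʳ-≤ 1# (fromℕ-mono-≤ {m} {n} m≤n)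

  <⇒≉ : ∀ {x y} → x < y → ¬ y ≈ x
  <⇒≉ x<y y≈x = proj₂ x<y (sym y≈x)

  *-inverseʳ-pos : ∀ {x} → 0# < x → x * x ⁻¹ ≈ 1#
  *-inverseʳ-pos 0<x = *-inverseʳ (<⇒≉ 0<x)

  ⁻¹-pos : ∀ {x} → 0# < x → 0# < x ⁻¹
  ⁻¹-pos {x} 0<x = ≰⇒> λ x⁻¹≤0 → <⇒≱ 0<1 (begin
    1#         ≈⟨ *-inverseʳ-pos 0<x ⟨
    x * x ⁻¹   ≤⟨ *-monoʳ-≤ (proj₁ 0<x) x⁻¹≤0 ⟩
    x * 0#     ≈⟨ zeroʳ x ⟩
    0#         ∎)
    where open ≤-Reasoning

  *-cancelʳ-≤ : ∀ {x y z} → 0# < z → x * z ≤ y * z → x ≤ y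
  *-cancelʳ-≤ {x} {y} {z} 0<z xz≤yz = begin
    x                ≈⟨ cancel x ⟩
    x * z * z ⁻¹     ≤⟨ *-monoˡ-≤ (proj₁ (⁻¹-pos 0<z)) xz≤yz ⟩
    y * z * z ⁻¹     ≈⟨ cancel y ⟨
    y                ∎
    where
    open ≤-Reasoning
    cancel : ∀ w → w ≈ w * z * z ⁻¹
    cancel w = sym (trans (*-assoc w z _) (trans (*-congˡ (*-inverseʳ-pos 0<z)) (*-identityʳ w)))

  *-pos : ∀ {x y} → 0# < x → 0# < y → 0# < x * y
  *-pos {x} {y} 0<x 0<y = ≰⇒> λ xy≤0 → <⇒≱ 0<x
    (*-cancelʳ-≤ 0<y (≤-trans xy≤0 (≤-reflexive (sym (zeroˡ y)))))

  -- If the naturals were bounded, their supremum `s` could be lowered to `s - 1#`, since `n + 1` is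
  -- a natural whenever `n` is.
  archimedean : ∀ x → ∃ λ n → x ≤ fromℕ n
  archimedean x with em {∃ λ n → x ≤ fromℕ n}
  ... | yes bounded = bounded
  ... | no unbounded = contradiction
    (least (s - 1#) λ { y (n , y≈n) → begin
      y                       ≈⟨ y≈n ⟩
      fromℕ n                 ≈⟨ solve 2 (λ e n → n := e :+ n :- e) refl 1# (fromℕ n) ⟩
      fromℕ (suc n) - 1#      ≤⟨ +-monoˡ-≤ (- 1#) (upper _ (suc n , refl)) ⟩
      s - 1#                  ∎ })
    (<⇒≱ (≰⇒> λ s≤s-1 → <⇒≱ 0<1 (+-cancelʳ-≤ (s - 1#) (begin
      1# + (s - 1#)    ≈⟨ solve 2 (λ e s → e :+ (s :- e) := s) refl 1# s ⟩
      s                ≤⟨ s≤s-1 ⟩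
      s - 1#           ≈⟨ +-identityˡ _ ⟨
      0# + (s - 1#)    ∎))))
    where
    open ≤-Reasoning
    sup : ∃ (IsSupremum λ y → ∃ λ n → y ≈ fromℕ n)
    sup = complete _ (0# , 0 , refl) (x , λ { y (n , y≈n) →
      ≤-trans (≤-reflexive y≈n) (proj₁ (≰⇒> λ x≤n → unbounded (n , x≤n))) })
    s : Carrier
    s = proj₁ sup
    upper = proj₁ (proj₂ sup)
    least = proj₂ (proj₂ sup)

  ^ⁿ-pos : ∀ {x} n → 0# < x → 0# < x ^ⁿ n
  ^ⁿ-pos zero    0<x = 0<1
  ^ⁿ-pos (suc n) 0<x = *-pos 0<x (^ⁿ-pos n 0<x)

  ^ⁿ-nonNeg : ∀ {x} n → 0# ≤ x → 0# ≤ x ^ⁿ n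
  ^ⁿ-nonNeg zero    0≤x = 0≤1
  ^ⁿ-nonNeg (suc n) 0≤x = *-nonNeg 0≤x (^ⁿ-nonNeg n 0≤x)

  ^ⁿ-mono-≤ : ∀ {x y} n → 0# ≤ x → x ≤ y → x ^ⁿ n ≤ y ^ⁿ n
  ^ⁿ-mono-≤ zero    0≤x x≤y = ≤-refl
  ^ⁿ-mono-≤ (suc n) 0≤x x≤y =
    *-mono-≤ (≤-trans 0≤x x≤y) (^ⁿ-nonNeg n 0≤x) x≤y (^ⁿ-mono-≤ n 0≤x x≤y)

  sum-mono-≤ : ∀ {n} {f g : Vector Carrier n} → (∀ i → f i ≤ g i) → sum f ≤ sum g
  sum-mono-≤ {zero}  f≤g = ≤-refl
  sum-mono-≤ {suc n} f≤g = +-mono-≤ (f≤g zero) (sum-mono-≤ (f≤g ∘ suc))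

  sum-nonNeg : ∀ {n} {f : Vector Carrier n} → (∀ i → 0# ≤ f i) → 0# ≤ sum f
  sum-nonNeg {zero}  0≤f = ≤-refl
  sum-nonNeg {suc n} 0≤f = +-nonNeg (0≤f zero) (sum-nonNeg (0≤f ∘ suc))

  term≤sum : ∀ {n} {f : Vector Carrier n} → (∀ i → 0# ≤ f i) → ∀ i → f i ≤ sum f
  term≤sum 0≤f zero    = x≤x+y (sum-nonNeg (0≤f ∘ suc))
  term≤sum 0≤f (suc i) = ≤-trans (term≤sum (0≤f ∘ suc) i) (x≤y+x (0≤f zero))

  sum-const : ∀ n x → sum {n} (λ _ → x) ≈ fromℕ n * x
  sum-const zero    x = sym (zeroˡ x)
  sum-const (suc n) x = trans (+-cong (sym (*-identityˡ x)) (sum-const n x)) (sym (distribʳ x 1# _))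

  sum-map-++ : ∀ {A : Set} (f : A → Carrier) {m n} (xs : Vector A m) (ys : Vector A n) →
               sum (λ i → f ((xs ++ ys) i)) ≈ sum (f ∘ xs) + sum (f ∘ ys)
  sum-map-++ f {zero}  xs ys = sym (+-identityˡ _)
  sum-map-++ f {suc m} xs ys = begin
    f (xs zero) + sum (λ i → f ((xs ++ ys) (suc i)))      ≈⟨ +-congˡ (sum-cong-≋ λ i → reflexive (≡.cong f (tail-++ i))) ⟩
    f (xs zero) + sum (λ i → f (((xs ∘ suc) ++ ys) i))    ≈⟨ +-congˡ (sum-map-++ f (xs ∘ suc) ys) ⟩
    f (xs zero) + (sum (f ∘ xs ∘ suc) + sum (f ∘ ys))     ≈⟨ +-assoc _ _ _ ⟨
    f (xs zero) + sum (f ∘ xs ∘ suc) + sum (f ∘ ys)       ∎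
    where
    open ≈-Reasoning
    tail-++ : ∀ i → (xs ++ ys) (suc i) ≡ ((xs ∘ suc) ++ ys) i
    tail-++ i with Fin.splitAt m i
    ... | inj₁ _ = ≡.refl
    ... | inj₂ _ = ≡.refl

  ∣∣-sel : ∀ x → ∣ x ∣ ≈ x ⊎ ∣ x ∣ ≈ - x
  ∣∣-sel x = ⊔-sel x (- x)

  ∣x∣-nonNeg : ∀ x → 0# ≤ ∣ x ∣
  ∣x∣-nonNeg x with total 0# x
  ... | inj₁ 0≤x = ≤-trans 0≤x (x≤x⊔y x (- x))
  ... | inj₂ x≤0 = ≤-trans (neg-nonNeg x≤0) (x≤y⊔x x (- x))

  ∣x∣*∣x∣≈x*x : ∀ x → ∣ x ∣ * ∣ x ∣ ≈ x * x
  ∣x∣*∣x∣≈x*x x with ∣∣-sel x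
  ... | inj₁ ∣x∣≈x  = *-cong ∣x∣≈x ∣x∣≈x
  ... | inj₂ ∣x∣≈-x = trans (*-cong ∣x∣≈-x ∣x∣≈-x) (solve 1 (λ x → :- x :* :- x := x :* x) refl x)

  ∣x∣≈0⇒x≈0 : ∀ {x} → ∣ x ∣ ≈ 0# → x ≈ 0#
  ∣x∣≈0⇒x≈0 {x} ∣x∣≈0 with ∣∣-sel x
  ... | inj₁ ∣x∣≈x  = trans (sym ∣x∣≈x) ∣x∣≈0
  ... | inj₂ ∣x∣≈-x = trans (sym (-‿involutive x))
    (trans (-‿cong (trans (sym ∣x∣≈-x) ∣x∣≈0)) -0≈0)

-- Real powers and their comparison with integer powers

module RealPowerProperties (em : ExcludedMiddle 0ℓ) (ℝ : CompleteOrderedField) (power : RealPower ℝ) where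
  open OrderedField em ℝ
  open RealPower power

  -- The power laws show `1# ^ a` and `x ^ 0#` to be idempotent; with positivity this determines
  -- both.
  x*x≈x⇒x≈1 : ∀ {x} → 0# < x → x * x ≈ x → x ≈ 1#
  x*x≈x⇒x≈1 {x} 0<x x*x≈x = begin
    x                ≈⟨ *-identityʳ x ⟨
    x * 1#           ≈⟨ *-congˡ (*-inverseʳ-pos 0<x) ⟨
    x * (x * x ⁻¹)   ≈⟨ *-assoc x x _ ⟨
    x * x * x ⁻¹     ≈⟨ *-congʳ x*x≈x ⟩
    x * x ⁻¹         ≈⟨ *-inverseʳ-pos 0<x ⟩
    1#               ∎
    where open ≈-Reasoning

  1^a≈1 : ∀ a → 1# ^ a ≈ 1#
  1^a≈1 a = x*x≈x⇒x≈1 (^-pos a 0<1)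
    (trans (sym (^-distribʳ-* a 0<1 0<1)) (^-cong (*-identityʳ 1#) refl))

  x^0≈1 : ∀ {x} → 0# < x → x ^ 0# ≈ 1#
  x^0≈1 0<x = x*x≈x⇒x≈1 (^-pos 0# 0<x)
    (trans (sym (^-distribˡ-+ 0# 0# 0<x)) (^-cong refl (+-identityʳ 0#)))

  -- The laws of `_^_` concern positive bases, so estimates for nonnegative bases branch here.
  pos∨≈0 : ∀ {x} → 0# ≤ x → 0# < x ⊎ x ≈ 0#
  pos∨≈0 {x} 0≤x with em {0# ≈ x}
  ... | yes 0≈x = inj₂ (sym 0≈x)
  ... | no 0≉x  = inj₁ (0≤x , 0≉x)

  ^-zero-base : ∀ {x a} → 0# < a → x ≈ 0# → x ^ a ≈ 0#
  ^-zero-base 0<a x≈0 = trans (^-cong x≈0 refl) (^-zeroˡ 0<a)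

  ^-nonNeg : ∀ {x a} → 0# < a → 0# ≤ x → 0# ≤ x ^ a
  ^-nonNeg 0<a 0≤x with pos∨≈0 0≤x
  ... | inj₁ 0<x = proj₁ (^-pos _ 0<x)
  ... | inj₂ x≈0 = ≤-reflexive (sym (^-zero-base 0<a x≈0))

  -- Monotonicity in the base follows from monotonicity in the exponent: y^a = (y/x)^a x^a, and
  -- (y/x)^a ≥ (y/x)^0 = 1 because y/x ≥ 1.
  ^-monoˡ-≤ : ∀ {x y a} → 0# < a → 0# ≤ x → x ≤ y → x ^ a ≤ y ^ a
  ^-monoˡ-≤ {x} {y} {a} 0<a 0≤x x≤y with pos∨≈0 0≤x
  ... | inj₂ x≈0 = ≤-trans (≤-reflexive (^-zero-base 0<a x≈0)) (^-nonNeg 0<a (≤-trans 0≤x x≤y))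
  ... | inj₁ 0<x = begin
    x ^ a                ≈⟨ *-identityˡ _ ⟨
    1# * x ^ a           ≈⟨ *-congʳ (x^0≈1 0<y/x) ⟨
    (y / x) ^ 0# * x ^ a ≤⟨ *-monoˡ-≤ (proj₁ (^-pos a 0<x)) (^-monoʳ-≤ 1≤y/x (proj₁ 0<a)) ⟩
    (y / x) ^ a * x ^ a  ≈⟨ ^-distribʳ-* a 0<y/x 0<x ⟨
    (y / x * x) ^ a      ≈⟨ ^-cong y/x*x≈y refl ⟩
    y ^ a                ∎
    where
    open ≤-Reasoning
    y/x*x≈y : y / x * x ≈ y
    y/x*x≈y = trans (*-assoc y _ x) (trans (*-congˡ (trans (*-comm _ x) (*-inverseʳ-pos 0<x))) (*-identityʳ y))
    1≤y/x : 1# ≤ y / x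
    1≤y/x = *-cancelʳ-≤ 0<x (≤-trans (≤-reflexive (*-identityˡ x)) (≤-trans x≤y (≤-reflexive (sym y/x*x≈y))))
    0<y/x : 0# < y / x
    0<y/x = <-≤-trans 0<1 1≤y/x

  ^-reflects-≤0 : ∀ {x a} → 0# ≤ x → x ^ a ≤ 0# → x ≈ 0#
  ^-reflects-≤0 {a = a} 0≤x x^a≤0 with pos∨≈0 0≤x
  ... | inj₁ 0<x = contradiction x^a≤0 (<⇒≱ (^-pos a 0<x))
  ... | inj₂ x≈0 = x≈0

  1/x-pos : ∀ {x} → 0# < x → 0# < 1# / x
  1/x-pos 0<x = *-pos 0<1 (⁻¹-pos 0<x)

  root-^ : ∀ {x p} → 0# < p → 0# < x → (x ^ p) ^ (1# / p) ≈ x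
  root-^ {x} {p} 0<p 0<x = begin
    (x ^ p) ^ (1# / p)  ≈⟨ ^-assocʳ p (1# / p) 0<x ⟩
    x ^ (p * (1# / p))  ≈⟨ ^-cong refl (trans (*-congˡ (*-identityˡ _)) (*-inverseʳ-pos 0<p)) ⟩
    x ^ 1#              ≈⟨ ^-identʳ 0<x ⟩
    x                   ∎
    where open ≈-Reasoning

  ^-fromℕ : ∀ {x} → 0# < x → ∀ n → x ^ fromℕ n ≈ x ^ⁿ n
  ^-fromℕ 0<x zero    = x^0≈1 0<x
  ^-fromℕ 0<x (suc n) = trans (^-distribˡ-+ 1# (fromℕ n) 0<x) (*-cong (^-identʳ 0<x) (^-fromℕ 0<x n))

  x^a≤1+x^K : ∀ {x a} K → 0# ≤ x → 0# < a → a ≤ fromℕ K → x ^ a ≤ 1# + x ^ⁿ K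
  x^a≤1+x^K {x} {a} K 0≤x 0<a a≤K with total x 1#
  ... | inj₁ x≤1 = begin
    x ^ a          ≤⟨ ^-monoˡ-≤ 0<a 0≤x x≤1 ⟩
    1# ^ a         ≈⟨ 1^a≈1 a ⟩
    1#             ≤⟨ x≤x+y (^ⁿ-nonNeg K 0≤x) ⟩
    1# + x ^ⁿ K    ∎
    where open ≤-Reasoning
  ... | inj₂ 1≤x = begin
    x ^ a          ≤⟨ ^-monoʳ-≤ 1≤x a≤K ⟩
    x ^ fromℕ K    ≈⟨ ^-fromℕ (<-≤-trans 0<1 1≤x) K ⟩
    x ^ⁿ K         ≤⟨ x≤y+x 0≤1 ⟩
    1# + x ^ⁿ K    ∎
    where open ≤-Reasoning

  ∣x∣^2h : ∀ x h → 0# < h → ∣ x ∣ ^ (h + h) ≈ (x * x) ^ h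
  ∣x∣^2h x h 0<h with pos∨≈0 (∣x∣-nonNeg x)
  ... | inj₁ 0<∣x∣ = begin
    ∣ x ∣ ^ (h + h)       ≈⟨ ^-distribˡ-+ h h 0<∣x∣ ⟩
    ∣ x ∣ ^ h * ∣ x ∣ ^ h ≈⟨ ^-distribʳ-* h 0<∣x∣ 0<∣x∣ ⟨
    (∣ x ∣ * ∣ x ∣) ^ h   ≈⟨ ^-cong (∣x∣*∣x∣≈x*x x) refl ⟩
    (x * x) ^ h           ∎
    where open ≈-Reasoning
  ... | inj₂ ∣x∣≈0 = trans (^-zero-base (<-≤-trans 0<h (x≤x+y (proj₁ 0<h))) ∣x∣≈0)
    (sym (^-zero-base 0<h (trans (*-congʳ (∣x∣≈0⇒x≈0 ∣x∣≈0)) (zeroˡ x))))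

  -- With t = x²/D this is t ^ h ≤ 1 + tᴷ, scaled by D ^ h · Dᴷ.
  power≤even-power : ∀ {D h} K → 0# < D → 0# < h → h ≤ fromℕ K → ∀ x →
    ∣ x ∣ ^ (h + h) * D ^ⁿ K ≤ D ^ h * (D ^ⁿ K + (x * x) ^ⁿ K)
  power≤even-power {D} {h} K 0<D 0<h h≤K x = begin
    ∣ x ∣ ^ (h + h) * D ^ⁿ K             ≈⟨ *-congʳ (∣x∣^2h x h 0<h) ⟩
    (x * x) ^ h * D ^ⁿ K                 ≤⟨ *-monoˡ-≤ (^ⁿ-nonNeg K (proj₁ 0<D)) bound ⟩
    D ^ h * (1# + t ^ⁿ K) * D ^ⁿ K       ≈⟨ *-assoc _ _ _ ⟩
    D ^ h * ((1# + t ^ⁿ K) * D ^ⁿ K)     ≈⟨ *-congˡ (trans (distribʳ _ _ _) (+-cong (*-identityˡ _) tK)) ⟩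
    D ^ h * (D ^ⁿ K + (x * x) ^ⁿ K)      ∎
    where
    open ≤-Reasoning
    t = x * x * D ⁻¹
    0≤t : 0# ≤ t
    0≤t = *-nonNeg (square-nonNeg x) (proj₁ (⁻¹-pos 0<D))
    x*x≈Dt : x * x ≈ D * t
    x*x≈Dt = sym (trans (*-comm D t) (trans (*-assoc _ _ D) (trans (*-congˡ (trans (*-comm _ D) (*-inverseʳ-pos 0<D))) (*-identityʳ _))))
    tK : t ^ⁿ K * D ^ⁿ K ≈ (x * x) ^ⁿ K
    tK = trans (*-comm _ _) (trans (sym (^ⁿ-distrib-* D t K)) (^ⁿ-congˡ K (sym x*x≈Dt)))
    bound : (x * x) ^ h ≤ D ^ h * (1# + t ^ⁿ K)
    bound with pos∨≈0 0≤t
    ... | inj₁ 0<t = begin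
      (x * x) ^ h              ≈⟨ ^-cong x*x≈Dt refl ⟩
      (D * t) ^ h              ≈⟨ ^-distribʳ-* h 0<D 0<t ⟩
      D ^ h * t ^ h            ≤⟨ *-monoʳ-≤ (proj₁ (^-pos h 0<D)) (x^a≤1+x^K K 0≤t 0<h h≤K) ⟩
      D ^ h * (1# + t ^ⁿ K)    ∎
    ... | inj₂ t≈0 = begin
      (x * x) ^ h              ≈⟨ ^-zero-base 0<h (trans x*x≈Dt (trans (*-congˡ t≈0) (zeroʳ D))) ⟩
      0#                       ≤⟨ *-nonNeg (proj₁ (^-pos h 0<D)) (+-nonNeg 0≤1 (^ⁿ-nonNeg K 0≤t)) ⟩
      D ^ h * (1# + t ^ⁿ K)    ∎

-- Balanced sign vectors and groups of them

module SignVectors (em : ExcludedMiddle 0ℓ) (ℝ : CompleteOrderedField) where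
  open OrderedField em ℝ

  infixr 7 _⊙_

  IsSign : Carrier → Set
  IsSign x = x * x ≈ 1#

  _⊙_ : ∀ {d} → Vector Carrier d → Vector Carrier d → Vector Carrier d
  (u ⊙ v) l = u l * v l

  ⟨_,_⟩ : ∀ {d} → Vector Carrier d → Vector Carrier d → Carrier
  ⟨ u , v ⟩ = sum (u ⊙ v)

  evenPower : ℕ → Carrier → Carrier
  evenPower K x = (x * x) ^ⁿ K

  evenPower-cong : ∀ K → evenPower K Preserves _≈_ ⟶ _≈_
  evenPower-cong K x≈y = ^ⁿ-congˡ K (*-cong x≈y x≈y)

  evenPower-nonNeg : ∀ K x → 0# ≤ evenPower K x
  evenPower-nonNeg K x = ^ⁿ-nonNeg K (square-nonNeg x)

  -- The price of one coordinate in the potential of `balance`.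
  spread : ℕ → Carrier
  spread K = 1# + fromℕ 4 * fromℕ K

  spread-pos : ∀ K → 0# < spread K
  spread-pos K = <-≤-trans 0<1 (x≤x+y (*-nonNeg (fromℕ-nonNeg 4) (fromℕ-nonNeg K)))

  -- The two bounds are proved together because
  -- (u + v)ᵏ⁺¹ + (u - v)ᵏ⁺¹ = u ((u + v)ᵏ + (u - v)ᵏ) + v ((u + v)ᵏ - (u - v)ᵏ),
  -- and symmetrically for the difference.
  module _ {u v W : Carrier} {K : ℕ} (0≤u : 0# ≤ u) (v²≤4u : v * v ≤ fromℕ 4 * u)
           (u+4K≤W : u + fromℕ 4 * fromℕ K ≤ W) where

    private
      P Q X : ℕ → Carrier
      P k = (u + v) ^ⁿ k
      Q k = (u - v) ^ⁿ k
      X k = W ^ⁿ k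

      u≤W : u ≤ W
      u≤W = ≤-trans (x≤x+y (*-nonNeg (fromℕ-nonNeg 4) (fromℕ-nonNeg K))) u+4K≤W

      0≤W : 0# ≤ W
      0≤W = ≤-trans 0≤u u≤W

      0≤X : ∀ k → 0# ≤ X k
      0≤X k = ^ⁿ-nonNeg k 0≤W

    symmetric-powers-≤ : ∀ k → k ℕ.≤ K →
      P k + Q k ≤ X k + X k × v * (P k - Q k) ≤ fromℕ 8 * fromℕ k * X k
    symmetric-powers-≤ zero    _   = ≤-refl , ≤-reflexive
      (solve 2 (λ v e → v :* (e :- e) := con (8 , 0) :* con (0 , 0) :* e) refl v 1#)
    symmetric-powers-≤ (suc k) k<K with symmetric-powers-≤ k (ℕ.<⇒≤ k<K)
    ... | sum≤ , difference≤ = (begin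
        (u + v) * P k + (u - v) * Q k
          ≈⟨ solve 4 (λ u v p q → (u :+ v) :* p :+ (u :- v) :* q := u :* (p :+ q) :+ v :* (p :- q)) refl u v (P k) (Q k) ⟩
        u * (P k + Q k) + v * (P k - Q k)
          ≤⟨ +-mono-≤ (*-monoʳ-≤ 0≤u sum≤) difference≤ ⟩
        -- Here 2u + 8k = 2(u + 4k) ≤ 2W: the summand `4K` in the bound on `W` pays for the
        -- difference term.
        u * (X k + X k) + fromℕ 8 * fromℕ k * X k
          ≈⟨ solve 3 (λ u k x → u :* (x :+ x) :+ con (8 , 0) :* k :* x
               := (u :+ con (4 , 0) :* k :+ (u :+ con (4 , 0) :* k)) :* x) refl u (fromℕ k) (X k) ⟩
        (u + fromℕ 4 * fromℕ k + (u + fromℕ 4 * fromℕ k)) * X k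
          ≤⟨ *-monoˡ-≤ (0≤X k) (+-mono-≤ u+4k≤W u+4k≤W) ⟩
        (W + W) * X k
          ≈⟨ distribʳ _ _ _ ⟩
        W * X k + W * X k ∎) , (begin
        v * ((u + v) * P k - (u - v) * Q k)
          ≈⟨ solve 4 (λ u v p q → v :* ((u :+ v) :* p :- (u :- v) :* q) := u :* (v :* (p :- q)) :+ v :* v :* (p :+ q)) refl u v (P k) (Q k) ⟩
        u * (v * (P k - Q k)) + v * v * (P k + Q k)
          ≤⟨ +-mono-≤ (*-monoʳ-≤ 0≤u difference≤) (*-monoʳ-≤ (square-nonNeg v) sum≤) ⟩
        u * (fromℕ 8 * fromℕ k * X k) + v * v * (X k + X k)
          ≤⟨ +-monoʳ-≤ _ (*-monoˡ-≤ (+-nonNeg (0≤X k) (0≤X k)) v²≤4u) ⟩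
        u * (fromℕ 8 * fromℕ k * X k) + fromℕ 4 * u * (X k + X k)
          ≈⟨ solve 3 (λ u k x → u :* (con (8 , 0) :* k :* x) :+ con (4 , 0) :* u :* (x :+ x)
               := u :* (con (8 , 0) :* (con (1 , 0) :+ k) :* x)) refl u (fromℕ k) (X k) ⟩
        u * (fromℕ 8 * fromℕ (suc k) * X k)
          ≤⟨ *-monoˡ-≤ (*-nonNeg (*-nonNeg (fromℕ-nonNeg 8) (fromℕ-nonNeg (suc k))) (0≤X k)) u≤W ⟩
        W * (fromℕ 8 * fromℕ (suc k) * X k)
          ≈⟨ solve 3 (λ w k x → w :* (con (8 , 0) :* k :* x) := con (8 , 0) :* k :* (w :* x)) refl W (fromℕ (suc k)) (X k) ⟩
        fromℕ 8 * fromℕ (suc k) * X (suc k) ∎)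
      where
      open ≤-Reasoning
      u+4k≤W : u + fromℕ 4 * fromℕ k ≤ W
      u+4k≤W = ≤-trans (+-monoʳ-≤ u (*-monoʳ-≤ (fromℕ-nonNeg 4) (fromℕ-mono-≤ (ℕ.<⇒≤ k<K)))) u+4K≤W

  -- Writing (s ± h)² + y as u ± v with u = s² + 1 + y and v = 2sh gives v² = 4s² ≤ 4u, so the
  -- symmetric power bound applies. The value of `spread K` arises here: `1#` is h², and `4K` is the
  -- slack of that bound.
  average-step : ∀ K {s h y} → IsSign h → 0# ≤ y →
    ((s + h) * (s + h) + y) ^ⁿ K + ((s - h) * (s - h) + y) ^ⁿ K ≤
    (s * s + (spread K + y)) ^ⁿ K + (s * s + (spread K + y)) ^ⁿ K
  average-step K {s} {h} {y} hh≈1 0≤y = begin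
    ((s + h) * (s + h) + y) ^ⁿ K + ((s - h) * (s - h) + y) ^ⁿ K
      ≈⟨ +-cong (^ⁿ-congˡ K plus) (^ⁿ-congˡ K minus) ⟩
    (u + v) ^ⁿ K + (u - v) ^ⁿ K
      ≤⟨ proj₁ (symmetric-powers-≤ {K = K} 0≤u v²≤4u (≤-reflexive W≈) K ℕ.≤-refl) ⟩
    (s * s + (spread K + y)) ^ⁿ K + (s * s + (spread K + y)) ^ⁿ K ∎
    where
    open ≤-Reasoning
    u v : Carrier
    u = s * s + 1# + y
    v = s * h + s * h
    0≤u : 0# ≤ u
    0≤u = +-nonNeg (+-nonNeg (square-nonNeg s) 0≤1) 0≤y
    plus : (s + h) * (s + h) + y ≈ u + v
    plus = trans (solve 3 (λ s h y → (s :+ h) :* (s :+ h) :+ y := s :* s :+ h :* h :+ y :+ (s :* h :+ s :* h)) refl s h y)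
      (+-congʳ (+-congʳ (+-congˡ hh≈1)))
    minus : (s - h) * (s - h) + y ≈ u - v
    minus = trans (solve 3 (λ s h y → (s :- h) :* (s :- h) :+ y := s :* s :+ h :* h :+ y :- (s :* h :+ s :* h)) refl s h y)
      (+-congʳ (+-congʳ (+-congˡ hh≈1)))
    W≈ : u + fromℕ 4 * fromℕ K ≈ s * s + (spread K + y)
    W≈ = solve 3 (λ s k y → s :* s :+ con (1 , 0) :+ y :+ con (4 , 0) :* k
      := s :* s :+ (con (1 , 0) :+ con (4 , 0) :* k :+ y)) refl s (fromℕ K) y
    v²≤4u : v * v ≤ fromℕ 4 * u
    v²≤4u = begin
      v * v                           ≈⟨ solve 2 (λ s h → (s :* h :+ s :* h) :* (s :* h :+ s :* h) := con (4 , 0) :* (s :* s :* (h :* h))) refl s h ⟩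
      fromℕ 4 * (s * s * (h * h))     ≈⟨ *-congˡ (trans (*-congˡ hh≈1) (*-identityʳ _)) ⟩
      fromℕ 4 * (s * s)               ≤⟨ *-monoʳ-≤ (fromℕ-nonNeg 4) (≤-trans (x≤x+y 0≤1) (x≤x+y 0≤y)) ⟩
      fromℕ 4 * u                     ∎

  -- The signs are chosen one coordinate at a time by the method of conditional
  -- expectations, s i being the contribution of the coordinates already chosen.
  balance : ∀ {n} K d (H : Vector (Vector Carrier d) n) → (∀ i l → IsSign (H i l)) →
    ∀ (s : Vector Carrier n) {x} → 0# ≤ x →
    ∃ λ g → (∀ l → IsSign (g l)) ×
      sum (λ i → ((s i + ⟨ H i , g ⟩) * (s i + ⟨ H i , g ⟩) + x) ^ⁿ K) ≤
      sum (λ i → (s i * s i + (fromℕ d * spread K + x)) ^ⁿ K)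
  balance {n} K zero    H H-sign s {x} 0≤x = (λ ()) , (λ ()) , ≤-reflexive (sum-cong-≋ {n} λ i → ^ⁿ-congˡ K
    (+-cong (*-cong (+-identityʳ _) (+-identityʳ _)) (sym (trans (+-congʳ (zeroˡ _)) (+-identityˡ x)))))
  balance {n} K (suc d) H H-sign s {x} 0≤x = choose (total (Φ 1#) T)
    where
    open ≤-Reasoning
    -- `y` prepays the `d` coordinates still to be chosen, so `Φ e` bounds the final sum that the
    -- recursion achieves after the first sign `e`.
    y T : Carrier
    y = fromℕ d * spread K + x
    T = sum (λ i → (s i * s i + (fromℕ (suc d) * spread K + x)) ^ⁿ K)
    0≤y : 0# ≤ y
    0≤y = +-nonNeg (*-nonNeg (fromℕ-nonNeg d) (proj₁ (spread-pos K))) 0≤x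
    s′ : Carrier → Vector Carrier n
    s′ e i = s i + H i zero * e
    Φ : Carrier → Carrier
    Φ e = sum (λ i → (s′ e i * s′ e i + y) ^ⁿ K)

    Φ-average : Φ 1# + Φ (- 1#) ≤ T + T
    Φ-average = begin
      Φ 1# + Φ (- 1#)
        ≈⟨ ∑-distrib-+ (λ i → (s′ 1# i * s′ 1# i + y) ^ⁿ K) _ ⟨
      sum (λ i → (s′ 1# i * s′ 1# i + y) ^ⁿ K + (s′ (- 1#) i * s′ (- 1#) i + y) ^ⁿ K)
        ≈⟨ sum-cong-≋ (λ i → +-cong (^ⁿ-congˡ K (+-congʳ (*-cong (s′1 i) (s′1 i)))) (^ⁿ-congˡ K (+-congʳ (*-cong (s′-1 i) (s′-1 i))))) ⟩
      sum (λ i → ((s i + H i zero) * (s i + H i zero) + y) ^ⁿ K + ((s i - H i zero) * (s i - H i zero) + y) ^ⁿ K)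
        ≤⟨ sum-mono-≤ (λ i → average-step K (H-sign i zero) 0≤y) ⟩
      sum (λ i → (s i * s i + (spread K + y)) ^ⁿ K + (s i * s i + (spread K + y)) ^ⁿ K)
        ≈⟨ sum-cong-≋ {n} (λ i → +-cong (^ⁿ-congˡ K (+-congˡ spread+y)) (^ⁿ-congˡ K (+-congˡ spread+y))) ⟩
      sum (λ i → (s i * s i + (fromℕ (suc d) * spread K + x)) ^ⁿ K + (s i * s i + (fromℕ (suc d) * spread K + x)) ^ⁿ K)
        ≈⟨ ∑-distrib-+ (λ i → (s i * s i + (fromℕ (suc d) * spread K + x)) ^ⁿ K) _ ⟩
      T + T ∎
      where
      s′1 : ∀ i → s′ 1# i ≈ s i + H i zero
      s′1 i = +-congˡ (*-identityʳ _)
      s′-1 : ∀ i → s′ (- 1#) i ≈ s i - H i zero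
      s′-1 i = +-congˡ (trans (sym (-‿distribʳ-* _ 1#)) (-‿cong (*-identityʳ _)))
      spread+y : spread K + y ≈ fromℕ (suc d) * spread K + x
      spread+y = solve 3 (λ d l x → l :+ (d :* l :+ x) := (con (1 , 0) :+ d) :* l :+ x) refl (fromℕ d) (spread K) x

    extend : ∀ {e} → IsSign e → Φ e ≤ T →
      ∃ λ g → (∀ l → IsSign (g l)) × sum (λ i → ((s i + ⟨ H i , g ⟩) * (s i + ⟨ H i , g ⟩) + x) ^ⁿ K) ≤ T
    extend {e} e-sign Φ≤T with balance K d (tail ∘ H) (λ i → H-sign i ∘ suc) (s′ e) 0≤x
    ... | g , g-sign , le = (e ∷ g) , (λ { zero → e-sign ; (suc l) → g-sign l }) ,
      ≤-trans (≤-reflexive (sum-cong-≋ {n} λ i → ^ⁿ-congˡ K (+-congʳ (*-cong (sym (+-assoc _ _ _)) (sym (+-assoc _ _ _))))))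
        (≤-trans le Φ≤T)

    choose : Φ 1# ≤ T ⊎ T ≤ Φ 1# → _
    choose (inj₁ Φ1≤T) = extend (*-identityʳ 1#) Φ1≤T
    choose (inj₂ T≤Φ1) = extend (trans (solve 1 (λ e → :- e :* :- e := e :* e) refl 1#) (*-identityʳ 1#))
      (+-cancelʳ-≤ T (begin
        Φ (- 1#) + T       ≤⟨ +-monoʳ-≤ _ T≤Φ1 ⟩
        Φ (- 1#) + Φ 1#    ≈⟨ +-comm _ _ ⟩
        Φ 1# + Φ (- 1#)    ≤⟨ Φ-average ⟩
        T + T              ∎))

  ⟨⟩-congʳ : ∀ {d} (w : Vector Carrier d) {u v : Vector Carrier d} →
             (∀ l → u l ≈ v l) → ⟨ w , u ⟩ ≈ ⟨ w , v ⟩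
  ⟨⟩-congʳ w u≈v = sum-cong-≋ λ l → *-congˡ (u≈v l)

  ⟨⟩-⊙ : ∀ {d} (u v w : Vector Carrier d) → ⟨ u ⊙ v , w ⟩ ≈ ⟨ u , v ⊙ w ⟩
  ⟨⟩-⊙ u v w = sum-cong-≋ λ l → *-assoc (u l) (v l) (w l)

  ones : ∀ {d} → Vector Carrier d
  ones _ = 1#

  -- Rows closed under entrywise multiplication, so that the distribution of the
  -- inner products of one row with all rows is the same for each row.
  record SignCode (K d n : ℕ) : Set where
    field
      row : Vector (Vector Carrier d) n
      row-sign : ∀ i l → IsSign (row i l)
      row-shift : ∀ {F} → F Preserves _≈_ ⟶ _≈_ → ∀ i v →
                  sum (λ j → F ⟨ row j , row i ⊙ v ⟩) ≈ sum (λ j → F ⟨ row j , v ⟩)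
      moment : sum (λ j → evenPower K ⟨ row j , ones ⟩) ≤
               evenPower K (fromℕ d) + fromℕ n * (fromℕ d * spread K) ^ⁿ K

  trivialCode : ∀ K d → SignCode K d 1
  trivialCode K d = record
    { row = λ _ → ones
    ; row-sign = λ _ _ → *-identityʳ 1#
    ; row-shift = λ F-cong i v → +-congʳ (F-cong (⟨⟩-congʳ ones λ l → *-identityˡ (v l)))
    ; moment = begin
        evenPower K ⟨ ones {d} , ones ⟩ + 0#    ≈⟨ +-identityʳ _ ⟩
        evenPower K ⟨ ones {d} , ones ⟩         ≈⟨ evenPower-cong K (trans (sum-const d _) (trans (*-congˡ (*-identityʳ 1#)) (*-identityʳ _))) ⟩
        evenPower K (fromℕ d)                   ≤⟨ x≤x+y (*-nonNeg (fromℕ-nonNeg 1) (^ⁿ-nonNeg K (*-nonNeg (fromℕ-nonNeg d) (proj₁ (spread-pos K))))) ⟩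
        evenPower K (fromℕ d) + fromℕ 1 * (fromℕ d * spread K) ^ⁿ K ∎
    }
    where open ≤-Reasoning

  -- The new half is the coset of the old rows by `g`, and `balance` started from zero bounds its
  -- moment. The term `evenPower K (fromℕ d)` stays single, since only the old half carries it.
  -- Nothing keeps `g` out of the old group: a repeated row is covered by the same moment bound.
  doubleCode : ∀ {K d n} → SignCode K d n → SignCode K d (n ℕ.+ n)
  doubleCode {K} {d} {n} code = record
    { row = rows
    ; row-sign = rows-sign
    ; row-shift = rows-shift
    ; moment = moments
    }
    where
    open SignCode code
    selection = balance K d row row-sign (λ _ → 0#) ≤-refl
    g = proj₁ selection
    g-sign = proj₁ (proj₂ selection)
    rows : Vector (Vector Carrier d) (n ℕ.+ n)
    rows = row ++ (λ i → row i ⊙ g)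

    ⊙-sign : ∀ {x y} → IsSign x → IsSign y → IsSign (x * y)
    ⊙-sign {x} {y} xx≈1 yy≈1 = trans (solve 2 (λ x y → x :* y :* (x :* y) := x :* x :* (y :* y)) refl x y)
      (trans (*-cong xx≈1 yy≈1) (*-identityʳ 1#))

    rows-sign : ∀ i l → IsSign (rows i l)
    rows-sign i l with Fin.splitAt n i
    ... | inj₁ i′ = row-sign i′ l
    ... | inj₂ i′ = ⊙-sign (row-sign i′ l) (g-sign l)

    split : ∀ {F} → F Preserves _≈_ ⟶ _≈_ → ∀ v →
      sum (λ j → F ⟨ rows j , v ⟩) ≈ sum (λ j → F ⟨ row j , v ⟩) + sum (λ j → F ⟨ row j , g ⊙ v ⟩)
    split {F} F-cong v = trans (sum-map-++ (λ r → F ⟨ r , v ⟩) row _)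
      (+-congˡ (sum-cong-≋ λ j → F-cong (⟨⟩-⊙ (row j) g v)))

    -- Doubling turns a sum at `v` into sums at `v` and `g ⊙ v`, so the invariant has to range over
    -- all `v`. A row of the old half preserves each of the two sums; a row of the new half
    -- exchanges them, as `g` squares to one.
    rows-shift : ∀ {F} → F Preserves _≈_ ⟶ _≈_ → ∀ i v →
      sum (λ j → F ⟨ rows j , rows i ⊙ v ⟩) ≈ sum (λ j → F ⟨ rows j , v ⟩)
    rows-shift {F} F-cong i v with Fin.splitAt n i
    ... | inj₁ i′ = begin
      sum (λ j → F ⟨ rows j , row i′ ⊙ v ⟩)       ≈⟨ split F-cong _ ⟩
      T (row i′ ⊙ v) + T (g ⊙ (row i′ ⊙ v))       ≈⟨ +-congˡ (T-cong λ l → solve 3 (λ g r v → g :* (r :* v) := r :* (g :* v)) refl (g l) (row i′ l) (v l)) ⟩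
      T (row i′ ⊙ v) + T (row i′ ⊙ (g ⊙ v))       ≈⟨ +-cong (row-shift F-cong i′ v) (row-shift F-cong i′ (g ⊙ v)) ⟩
      T v + T (g ⊙ v)                             ≈⟨ split F-cong v ⟨
      sum (λ j → F ⟨ rows j , v ⟩)                ∎
      where
      open ≈-Reasoning
      T : Vector Carrier d → Carrier
      T v = sum (λ j → F ⟨ row j , v ⟩)
      T-cong : ∀ {u v : Vector Carrier d} → (∀ l → u l ≈ v l) → T u ≈ T v
      T-cong u≈v = sum-cong-≋ λ j → F-cong (⟨⟩-congʳ (row j) u≈v)
    ... | inj₂ i′ = begin
      sum (λ j → F ⟨ rows j , (row i′ ⊙ g) ⊙ v ⟩)                 ≈⟨ split F-cong _ ⟩
      T ((row i′ ⊙ g) ⊙ v) + T (g ⊙ ((row i′ ⊙ g) ⊙ v))           ≈⟨ +-cong (T-cong λ l → *-assoc _ _ _) (T-cong λ l → cancel-g (row i′ l) l) ⟩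
      T (row i′ ⊙ (g ⊙ v)) + T (row i′ ⊙ v)                       ≈⟨ +-cong (row-shift F-cong i′ (g ⊙ v)) (row-shift F-cong i′ v) ⟩
      T (g ⊙ v) + T v                                             ≈⟨ +-comm _ _ ⟩
      T v + T (g ⊙ v)                                             ≈⟨ split F-cong v ⟨
      sum (λ j → F ⟨ rows j , v ⟩)                                ∎
      where
      open ≈-Reasoning
      T : Vector Carrier d → Carrier
      T v = sum (λ j → F ⟨ row j , v ⟩)
      T-cong : ∀ {u v : Vector Carrier d} → (∀ l → u l ≈ v l) → T u ≈ T v
      T-cong u≈v = sum-cong-≋ λ j → F-cong (⟨⟩-congʳ (row j) u≈v)
      cancel-g : ∀ r l → g l * (r * g l * v l) ≈ r * v l
      cancel-g r l = trans (solve 3 (λ g r v → g :* (r :* g :* v) := g :* g :* (r :* v)) refl (g l) r (v l))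
        (trans (*-congʳ (g-sign l)) (*-identityˡ _))

    new-moment : sum (λ j → evenPower K ⟨ row j , g ⊙ ones ⟩) ≤ fromℕ n * (fromℕ d * spread K) ^ⁿ K
    new-moment = begin
      sum (λ j → evenPower K ⟨ row j , g ⊙ ones ⟩)
        ≈⟨ sum-cong-≋ (λ j → ^ⁿ-congˡ K (trans (*-cong (shape j) (shape j)) (sym (+-identityʳ _)))) ⟩
      sum (λ j → ((0# + ⟨ row j , g ⟩) * (0# + ⟨ row j , g ⟩) + 0#) ^ⁿ K)
        ≤⟨ proj₂ (proj₂ selection) ⟩
      sum {n} (λ j → (0# * 0# + (fromℕ d * spread K + 0#)) ^ⁿ K)
        ≈⟨ sum-const n _ ⟩
      fromℕ n * (0# * 0# + (fromℕ d * spread K + 0#)) ^ⁿ K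
        ≈⟨ *-congˡ (^ⁿ-congˡ K (trans (+-cong (zeroˡ 0#) (+-identityʳ _)) (+-identityˡ _))) ⟩
      fromℕ n * (fromℕ d * spread K) ^ⁿ K ∎
      where
      open ≤-Reasoning
      shape : ∀ j → ⟨ row j , g ⊙ ones ⟩ ≈ 0# + ⟨ row j , g ⟩
      shape j = trans (⟨⟩-congʳ (row j) λ l → *-identityʳ (g l)) (sym (+-identityˡ _))

    moments : sum (λ j → evenPower K ⟨ rows j , ones ⟩) ≤
              evenPower K (fromℕ d) + fromℕ (n ℕ.+ n) * (fromℕ d * spread K) ^ⁿ K
    moments = begin
      sum (λ j → evenPower K ⟨ rows j , ones ⟩)
        ≈⟨ split (evenPower-cong K) ones ⟩
      sum (λ j → evenPower K ⟨ row j , ones ⟩) + sum (λ j → evenPower K ⟨ row j , g ⊙ ones ⟩)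
        ≤⟨ +-mono-≤ moment new-moment ⟩
      evenPower K (fromℕ d) + fromℕ n * Y + fromℕ n * Y
        ≈⟨ +-assoc _ _ _ ⟩
      evenPower K (fromℕ d) + (fromℕ n * Y + fromℕ n * Y)
        ≈⟨ +-congˡ (trans (sym (distribʳ Y _ _)) (*-congʳ (sym (×-homo-+ 1# n n)))) ⟩
      evenPower K (fromℕ d) + fromℕ (n ℕ.+ n) * Y ∎
      where
      open ≤-Reasoning
      Y = (fromℕ d * spread K) ^ⁿ K

  -- Sizes are powers of two, whence the factor two between `n` and `X`.
  exists-code : ∀ K d {X} → 1# ≤ X → ∃ λ n → SignCode K d n × fromℕ n ≤ X × X ≤ fromℕ n + fromℕ n
  exists-code K d {X} 1≤X = finish (archimedean X)
    where
    -- `M` is fuel: after `M` doublings `n` exceeds `M`, so a bound for `X` from `archimedean` is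
    -- enough.
    grow : ∀ M → ∃ λ n → SignCode K d n × fromℕ n ≤ X × (X ≤ fromℕ n + fromℕ n ⊎ M ℕ.< n)
    grow zero = 1 , trivialCode K d , ≤-trans (≤-reflexive (+-identityʳ 1#)) 1≤X , inj₂ ℕ.≤-refl
    grow (suc M) with grow M
    ... | n , code , n≤X , inj₁ X≤2n = n , code , n≤X , inj₁ X≤2n
    ... | n , code , n≤X , inj₂ M<n with total X (fromℕ n + fromℕ n)
    ...   | inj₁ X≤2n = n , code , n≤X , inj₁ X≤2n
    ...   | inj₂ 2n≤X = n ℕ.+ n , doubleCode code , ≤-trans (≤-reflexive (×-homo-+ 1# n n)) 2n≤X ,
      inj₂ (ℕ.+-mono-≤ (ℕ.≤-trans (ℕ.s≤s ℕ.z≤n) M<n) M<n)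

    finish : (∃ λ M → X ≤ fromℕ M) → _
    finish (M , X≤M) with grow M
    ... | n , code , n≤X , inj₁ X≤2n = n , code , n≤X , X≤2n
    ... | n , code , n≤X , inj₂ M<n  = n , code , n≤X ,
      ≤-trans X≤M (≤-trans (fromℕ-mono-≤ (ℕ.<⇒≤ M<n)) (x≤x+y (fromℕ-nonNeg n)))

  spike : ∀ {n} → Carrier → Fin n → Vector Carrier n
  spike x i j = if does (i Fin.≟ j) then x else 0#

  spike-diagonal : ∀ {n} x (i : Fin n) → spike x i i ≡ x
  spike-diagonal x i with i Fin.≟ i
  ... | yes _  = ≡.refl
  ... | no i≢i = contradiction ≡.refl i≢i

  spike-off-diagonal : ∀ {n} x {i j : Fin n} → i ≢ j → spike x i j ≡ 0#
  spike-off-diagonal x {i} {j} i≢j with i Fin.≟ j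
  ... | yes i≡j = contradiction i≡j i≢j
  ... | no _    = ≡.refl

  -- The shift by row `i` reduces the sum to the one in `moment`. The spike removes the inner
  -- product of row `i` with itself, whose even power is exactly the first summand there, so that
  -- the summand cancels.
  residual-moment : ∀ {K d n} (code : SignCode (suc K) d n) → let open SignCode code in ∀ i →
    sum (λ j → evenPower (suc K) (⟨ row j , row i ⟩ - spike (fromℕ d) i j)) ≤
    fromℕ n * (fromℕ d * spread (suc K)) ^ⁿ suc K
  residual-moment {K} {d} {n} code i = +-cancelʳ-≤ (E (fromℕ d)) (begin
    sum (λ j → E (⟨ row j , row i ⟩ - b j)) + E (fromℕ d)
      ≈⟨ +-congˡ (evenPower-cong (suc K) (reflexive (≡.sym (spike-diagonal (fromℕ d) i)))) ⟩
    sum (λ j → E (⟨ row j , row i ⟩ - b j)) + E (b i)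
      ≤⟨ +-monoʳ-≤ _ (term≤sum (λ j → evenPower-nonNeg (suc K) (b j)) i) ⟩
    sum (λ j → E (⟨ row j , row i ⟩ - b j)) + sum (λ j → E (b j))
      ≈⟨ ∑-distrib-+ (λ j → E (⟨ row j , row i ⟩ - b j)) _ ⟨
    sum (λ j → E (⟨ row j , row i ⟩ - b j) + E (b j))
      ≈⟨ sum-cong-≋ peel ⟩
    sum (λ j → E ⟨ row j , row i ⟩)
      ≈⟨ sum-cong-≋ (λ j → evenPower-cong (suc K) (⟨⟩-congʳ (row j) λ l → sym (*-identityʳ (row i l)))) ⟩
    sum (λ j → E ⟨ row j , row i ⊙ ones ⟩)
      ≈⟨ row-shift (evenPower-cong (suc K)) i ones ⟩
    sum (λ j → E ⟨ row j , ones ⟩)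
      ≤⟨ moment ⟩
    E (fromℕ d) + fromℕ n * (fromℕ d * spread (suc K)) ^ⁿ suc K
      ≈⟨ +-comm _ _ ⟩
    fromℕ n * (fromℕ d * spread (suc K)) ^ⁿ suc K + E (fromℕ d) ∎)
    where
    open SignCode code
    open ≤-Reasoning
    E : Carrier → Carrier
    E = evenPower (suc K)
    b : Vector Carrier n
    b = spike (fromℕ d) i
    E0 : ∀ {x} → x ≈ 0# → E x ≈ 0#
    E0 x≈0 = trans (*-congʳ (trans (*-congʳ x≈0) (zeroˡ _))) (zeroˡ _)
    norm : ⟨ row i , row i ⟩ ≈ fromℕ d
    norm = trans (sum-cong-≋ (row-sign i)) (trans (sum-const d 1#) (*-identityʳ _))
    peel : ∀ j → E (⟨ row j , row i ⟩ - b j) + E (b j) ≈ E ⟨ row j , row i ⟩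
    peel j with i Fin.≟ j
    ... | yes ≡.refl = trans (+-cong (E0 (trans (+-congʳ norm) (-‿inverseʳ _))) (evenPower-cong (suc K) (sym norm))) (+-identityˡ _)
    ... | no _ = trans (+-cong (evenPower-cong (suc K) (trans (+-congˡ -0≈0) (+-identityʳ _))) (E0 refl)) (+-identityʳ _)

-- Finite probability estimates and a lower bound on expectations

module Sumℕ = Algebra.Properties.Semiring.Sum ℕ.+-*-semiring

module Probability (em : ExcludedMiddle 0ℓ) (ℝ : CompleteOrderedField) (power : RealPower ℝ)
                   (space : Regression.ProbabilitySpace ℝ power) where
  open OrderedField em ℝ
  open Regression.ProbabilitySpace space

  partialSum : (ℕ → Carrier) → ℕ → Carrier
  partialSum t K = sum {K} (t ∘ toℕ)

  partialSum-suc : ∀ t K → partialSum t (suc K) ≈ partialSum t K + t K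
  partialSum-suc t K = trans (sum-init-last (t ∘ toℕ))
    (+-cong (sum-cong-≋ λ k → reflexive (≡.cong t (Fin.toℕ-inject₁ {K} k))) (reflexive (≡.cong t (Fin.toℕ-fromℕ K))))

  measurable-∅ : Measurable ∅
  measurable-∅ = measurable-≐ ((λ ¬u → ¬u _) , λ ()) (measurable-∁ measurable-U)

  private
    pair : Pred Ω 0ℓ → Pred Ω 0ℓ → ℕ → Pred Ω 0ℓ
    pair E F 0             = E
    pair E F 1             = F
    pair E F (suc (suc _)) = ∅

    pair-measurable : ∀ {E F} → Measurable E → Measurable F → ∀ k → Measurable (pair E F k)
    pair-measurable mE mF 0             = mE
    pair-measurable mE mF 1             = mF
    pair-measurable mE mF (suc (suc _)) = measurable-∅

    ⋃-pair : ∀ {E F} → ⋃ ℕ (pair E F) ≐ E ∪ F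
    ⋃-pair = (λ { (0 , e) → inj₁ e ; (1 , f) → inj₂ f }) , λ { (inj₁ e) → 0 , e ; (inj₂ f) → 1 , f }

  measurable-∪ : ∀ {E F} → Measurable E → Measurable F → Measurable (E ∪ F)
  measurable-∪ mE mF = measurable-≐ ⋃-pair (measurable-⋃ _ (pair-measurable mE mF))

  measurable-∩ : ∀ {E F} → Measurable E → Measurable F → Measurable (E ∩ F)
  measurable-∩ {E} {F} mE mF = measurable-≐ deMorgan (measurable-∁ (measurable-∪ (measurable-∁ mE) (measurable-∁ mF)))
    where
    stable : ∀ (P : Pred Ω 0ℓ) {ω} → ¬ ¬ P ω → P ω
    stable P {ω} ¬¬p with em {P ω}
    ... | yes p = p
    ... | no ¬p = contradiction ¬p ¬¬p
    deMorgan : ∁ (∁ E ∪ ∁ F) ≐ E ∩ F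
    deMorgan = (λ ¬∪ → stable E (¬∪ ∘ inj₁) , stable F (¬∪ ∘ inj₂)) ,
      λ { (e , f) → λ { (inj₁ ¬e) → ¬e e ; (inj₂ ¬f) → ¬f f } }

  -- Countable additivity for `E`, `F`, `∅`, `∅`, ...: the partial sums are constant from length two
  -- on, so their supremum is the sum of two terms.
  ℙ-∪ : ∀ {E F} → Measurable E → Measurable F → E ⊥ F → ℙ (E ∪ F) ≈ ℙ E + ℙ F
  ℙ-∪ {E} {F} mE mF E⊥F = trans (sym (ℙ-≐ (measurable-⋃ _ m) ⋃-pair))
    (≤-antisym (least _ bounded) (≤-trans (≤-reflexive (+-congˡ (sym (+-identityʳ _)))) (upper _ (2 , refl))))
    where
    m = pair-measurable mE mF
    disjoint : ∀ {j k} → j ≢ k → pair E F j ⊥ pair E F k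
    disjoint {0} {0} j≢k _ = j≢k ≡.refl
    disjoint {0} {1} _ = E⊥F
    disjoint {1} {0} _ (f , e) = E⊥F (e , f)
    disjoint {1} {1} j≢k _ = j≢k ≡.refl
    disjoint {suc (suc _)} {_} _ (() , _)
    disjoint {0} {suc (suc _)} _ (_ , ())
    disjoint {1} {suc (suc _)} _ (_ , ())
    series = ℙ-⋃ (pair E F) m disjoint
    upper = proj₁ series
    least = proj₂ series
    bounded : ∀ s → (∃ λ K → s ≈ partialSum (ℙ ∘ pair E F) K) → s ≤ ℙ E + ℙ F
    bounded s (0 , s≈) = ≤-trans (≤-reflexive s≈) (+-nonNeg (ℙ-nonNeg mE) (ℙ-nonNeg mF))
    bounded s (1 , s≈) = ≤-trans (≤-reflexive (trans s≈ (+-identityʳ _))) (x≤x+y (ℙ-nonNeg mF))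
    bounded s (suc (suc K) , s≈) = ≤-reflexive (trans s≈ (+-congˡ (trans (+-congˡ zeros) (+-identityʳ _))))
      where
      zeros : sum {K} (λ _ → ℙ ∅) ≈ 0#
      zeros = trans (sum-const K _) (trans (*-congˡ ℙ-∅) (zeroʳ _))

  ℙ-split : ∀ {E F} → Measurable E → Measurable F → ℙ E ≈ ℙ (E ∩ F) + ℙ (E ∩ ∁ F)
  ℙ-split {E} {F} mE mF = trans (ℙ-≐ mE (cases , [ proj₁ , proj₁ ]′))
    (ℙ-∪ (measurable-∩ mE mF) (measurable-∩ mE (measurable-∁ mF)) λ { ((_ , f) , (_ , ¬f)) → ¬f f })
    where
    cases : E ⊆ (E ∩ F) ∪ (E ∩ ∁ F)
    cases {ω} e with em {F ω}
    ... | yes f = inj₁ (e , f)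
    ... | no ¬f = inj₂ (e , ¬f)

  -- Bonferroni's inequality, the form in which failure probabilities are added up below. The slack
  -- is the probability that both events fail.
  ℙ-∩-lower : ∀ {E F} → Measurable E → Measurable F → ℙ E + ℙ F ≤ ℙ (E ∩ F) + 1#
  ℙ-∩-lower {E} {F} mE mF = begin
    ℙ E + ℙ F                                            ≈⟨ +-congʳ (ℙ-split mE mF) ⟩
    ℙ (E ∩ F) + ℙ (E ∩ ∁ F) + ℙ F                        ≤⟨ x≤x+y (ℙ-nonNeg (measurable-∩ (measurable-∁ mF) (measurable-∁ mE))) ⟩
    ℙ (E ∩ F) + ℙ (E ∩ ∁ F) + ℙ F + ℙ (∁ F ∩ ∁ E)        ≈⟨ solve 4 (λ a b c d → a :+ b :+ c :+ d := a :+ (c :+ (b :+ d))) refl _ _ _ _ ⟩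
    ℙ (E ∩ F) + (ℙ F + (ℙ (E ∩ ∁ F) + ℙ (∁ F ∩ ∁ E)))    ≈⟨ +-congˡ (+-cong (ℙ-≐ mF ((_ ,_) , proj₂)) (+-congʳ (ℙ-≐ (measurable-∩ mE (measurable-∁ mF)) swap))) ⟩
    ℙ (E ∩ F) + (ℙ (U ∩ F) + (ℙ (∁ F ∩ E) + ℙ (∁ F ∩ ∁ E)))  ≈⟨ +-congˡ (+-congˡ (trans (sym (ℙ-split (measurable-∁ mF) mE)) (ℙ-≐ (measurable-∁ mF) ((_ ,_) , proj₂)))) ⟩
    ℙ (E ∩ F) + (ℙ (U ∩ F) + ℙ (U ∩ ∁ F))                ≈⟨ +-congˡ (trans (sym (ℙ-split measurable-U mF)) ℙ-U) ⟩
    ℙ (E ∩ F) + 1#                                       ∎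
    where
    open ≤-Reasoning
    swap : (E ∩ ∁ F) ≐ (∁ F ∩ E)
    swap = (λ { (e , ¬f) → ¬f , e }) , λ { (¬f , e) → e , ¬f }

  ℙ-empty : ∀ {E} → Measurable E → (∀ {ω} → ¬ E ω) → ℙ E ≈ 0#
  ℙ-empty mE ¬E = trans (ℙ-≐ mE ((λ e → ⊥-elim (¬E e)) , λ ())) ℙ-∅

  -- Σᵢ 1_{Gᵢ} ≤ Σᵢ fᵢ ≤ k on H, integrated without an integral.
  double-counting : ∀ {n} (G : Fin n → Pred Ω 0ℓ) → (∀ i → Measurable (G i)) →
    ∀ (f : Ω → Fin n → ℕ) → (∀ {ω} i → G i ω → 1 ℕ.≤ f ω i) →
    ∀ k {H} → Measurable H → (∀ {ω} → H ω → Sumℕ.sum (f ω) ℕ.≤ k) →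
    sum (λ i → ℙ (G i ∩ H)) ≤ fromℕ k * ℙ H
  double-counting {zero} G mG f f≥1 k mH f≤k = *-nonNeg (fromℕ-nonNeg k) (ℙ-nonNeg mH)
  double-counting {suc n} G mG f f≥1 k {H} mH f≤k = begin
    ℙ (G₀ ∩ H) + sum (λ i → ℙ (G (suc i) ∩ H))
      ≈⟨ +-cong (ℙ-≐ (measurable-∩ m₀ mH) swap) (sum-cong-≋ split) ⟩
    ℙ H₁ + sum (λ i → ℙ (G (suc i) ∩ H₁) + ℙ (G (suc i) ∩ H₂))
      ≈⟨ +-congˡ (∑-distrib-+ (λ i → ℙ (G (suc i) ∩ H₁)) _) ⟩
    ℙ H₁ + (sum (λ i → ℙ (G (suc i) ∩ H₁)) + sum (λ i → ℙ (G (suc i) ∩ H₂)))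
      ≈⟨ +-assoc _ _ _ ⟨
    ℙ H₁ + sum (λ i → ℙ (G (suc i) ∩ H₁)) + sum (λ i → ℙ (G (suc i) ∩ H₂))
      ≤⟨ +-mono-≤ (first k f≤k) (double-counting (G ∘ suc) (mG ∘ suc) (λ ω → f ω ∘ suc) (f≥1 ∘ suc) k mH₂
           λ { (h , _) → ℕ.≤-trans (ℕ.m≤n+m _ _) (f≤k h) }) ⟩
    fromℕ k * ℙ H₁ + fromℕ k * ℙ H₂
      ≈⟨ distribˡ _ _ _ ⟨
    fromℕ k * (ℙ H₁ + ℙ H₂)
      ≈⟨ *-congˡ (ℙ-split mH m₀) ⟨
    fromℕ k * ℙ H ∎
    where
    open ≤-Reasoning
    G₀ H₁ H₂ : Pred Ω 0ℓ
    G₀ = G zero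
    H₁ = H ∩ G₀
    H₂ = H ∩ ∁ G₀
    m₀ = mG zero
    mH₁ = measurable-∩ mH m₀
    mH₂ = measurable-∩ mH (measurable-∁ m₀)
    swap : (G₀ ∩ H) ≐ H₁
    swap = (λ { (g , h) → h , g }) , λ { (h , g) → g , h }
    split : ∀ i → ℙ (G (suc i) ∩ H) ≈ ℙ (G (suc i) ∩ H₁) + ℙ (G (suc i) ∩ H₂)
    split i = trans (ℙ-split mGH m₀) (+-cong (ℙ-≐ (measurable-∩ mGH m₀) assoc) (ℙ-≐ (measurable-∩ mGH (measurable-∁ m₀)) assoc))
      where
      mGH = measurable-∩ (mG (suc i)) mH
      assoc : ∀ {A B C : Pred Ω 0ℓ} → ((A ∩ B) ∩ C) ≐ (A ∩ (B ∩ C))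
      assoc = (λ { ((a , b) , c) → a , b , c }) , λ { (a , b , c) → (a , b) , c }
    -- On `H₁` the event `G₀` uses at least one unit of the budget `k`. With no budget `H₁` is
    -- empty; otherwise the remaining events share one unit less.
    first : ∀ k → (∀ {ω} → H ω → Sumℕ.sum (f ω) ℕ.≤ k) →
      ℙ H₁ + sum (λ i → ℙ (G (suc i) ∩ H₁)) ≤ fromℕ k * ℙ H₁
    first zero f≤0 = ≤-reflexive (trans (+-cong H₁≈0 (trans (sum-cong-≋ λ i → ℙ-empty (measurable-∩ (mG (suc i)) mH₁) (empty ∘ proj₂))
      (trans (sum-const n 0#) (zeroʳ _)))) (trans (+-identityʳ 0#) (sym (zeroˡ _))))
      where
      empty : ∀ {ω} → ¬ H₁ ω
      empty (h , g) = ℕ.<⇒≱ (f≥1 zero g) (ℕ.≤-trans (ℕ.m≤m+n _ _) (f≤0 h))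
      H₁≈0 = ℙ-empty mH₁ empty
    first (suc k) f≤1+k = begin
      ℙ H₁ + sum (λ i → ℙ (G (suc i) ∩ H₁))   ≤⟨ +-monoʳ-≤ _ (double-counting (G ∘ suc) (mG ∘ suc) (λ ω → f ω ∘ suc) (f≥1 ∘ suc) k mH₁
        λ { (h , g) → ℕ.s≤s⁻¹ (ℕ.≤-trans (ℕ.+-monoˡ-≤ _ (f≥1 zero g)) (f≤1+k h)) }) ⟩
      ℙ H₁ + fromℕ k * ℙ H₁                   ≈⟨ +-congʳ (*-identityˡ _) ⟨
      1# * ℙ H₁ + fromℕ k * ℙ H₁              ≈⟨ distribʳ _ _ _ ⟨
      fromℕ (suc k) * ℙ H₁                    ∎

  module _ {N : Ω → ℕ} (N-measurable : ∀ k → Measurable (λ ω → N ω ≡ k)) where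

    Below : ℕ → Pred Ω 0ℓ
    Below K ω = N ω ℕ.< K

    Level : ℕ → Pred Ω 0ℓ
    Level k ω = N ω ≡ k

    Below-suc : ∀ K → Below (suc K) ≐ (Below K ∪ Level K)
    Below-suc K = (λ N<1+K → ℕ.m≤n⇒m<n∨m≡n (ℕ.s≤s⁻¹ N<1+K)) ,
      [ ℕ.m≤n⇒m≤1+n , (λ { ≡.refl → ℕ.≤-refl }) ]′

    Below-measurable : ∀ K → Measurable (Below K)
    Below-measurable zero    = measurable-≐ ((λ ()) , λ ()) measurable-∅
    Below-measurable (suc K) = measurable-≐ ((λ {ω} → proj₂ (Below-suc K) {ω}) , λ {ω} → proj₁ (Below-suc K) {ω})
      (measurable-∪ (Below-measurable K) (N-measurable K))

    ℙ-∩-Below-suc : ∀ {E} → Measurable E → ∀ K →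
      ℙ (E ∩ Below (suc K)) ≈ ℙ (E ∩ Below K) + ℙ (E ∩ Level K)
    ℙ-∩-Below-suc {E} mE K = trans (ℙ-≐ (measurable-∩ mE (Below-measurable (suc K))) ∩-∪)
      (ℙ-∪ (measurable-∩ mE (Below-measurable K)) (measurable-∩ mE (N-measurable K))
        λ { ((_ , N<K) , (_ , ≡.refl)) → ℕ.n≮n _ N<K })
      where
      ∩-∪ : (E ∩ Below (suc K)) ≐ ((E ∩ Below K) ∪ (E ∩ Level K))
      ∩-∪ = (λ { {ω} (e , N<) → [ (λ b → inj₁ (e , b)) , (λ l → inj₂ (e , l)) ]′ (proj₁ (Below-suc K) {ω} N<) }) ,
        λ { {ω} (inj₁ (e , b)) → e , proj₂ (Below-suc K) {ω} (inj₁ b) ; {ω} (inj₂ (e , l)) → e , proj₂ (Below-suc K) {ω} (inj₂ l) }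

    ℙ-∩-Below-zero : ∀ {E} → Measurable E → ℙ (E ∩ Below 0) ≈ 0#
    ℙ-∩-Below-zero mE = ℙ-empty (measurable-∩ mE (Below-measurable 0)) λ { (_ , ()) }

    ℙ-Below : ∀ K → ℙ (Below K) ≈ partialSum (ℙ ∘ Level) K
    ℙ-Below zero    = ℙ-empty (Below-measurable 0) λ ()
    ℙ-Below (suc K) = trans (ℙ-≐ (Below-measurable (suc K)) ((λ {ω} → proj₁ (Below-suc K) {ω}) , λ {ω} → proj₂ (Below-suc K) {ω}))
      (trans (ℙ-∪ (Below-measurable K) (N-measurable K) λ { (N<K , ≡.refl) → ℕ.n≮n _ N<K })
        (trans (+-congʳ (ℙ-Below K)) (sym (partialSum-suc (ℙ ∘ Level) K))))

    -- Continuity from below: the levels partition `Ω`, so `1#` is the supremum of the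
    -- `ℙ (Below K)`. It need not be attained, hence the strict bound on `θ`.
    Below-exhausts : ∀ {θ} → θ < 1# → ∃ λ K → θ ≤ ℙ (Below K)
    Below-exhausts {θ} θ<1 with em {∃ λ K → θ ≤ ℙ (Below K)}
    ... | yes found = found
    ... | no none = contradiction 1≤θ (<⇒≱ θ<1)
      where
      open ≤-Reasoning
      series = ℙ-⋃ Level N-measurable λ { j≢k (≡.refl , ≡.refl) → j≢k ≡.refl }
      1≤θ : 1# ≤ θ
      1≤θ = begin
        1#               ≈⟨ ℙ-U ⟨
        ℙ U              ≈⟨ ℙ-≐ measurable-U ((λ {ω} _ → N ω , ≡.refl) , _) ⟩
        ℙ (⋃ ℕ Level)    ≤⟨ proj₂ series θ (λ { s (K , s≈) → ≤-trans (≤-reflexive (trans s≈ (sym (ℙ-Below K))))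
                              (proj₁ (≰⇒> λ θ≤ → none (K , θ≤))) }) ⟩
        θ                ∎

    module _ {n} (G : Fin n → Pred Ω 0ℓ) (mG : ∀ i → Measurable (G i))
             (f : Ω → Fin n → ℕ) (f≥1 : ∀ {ω} i → G i ω → 1 ℕ.≤ f ω i)
             (Σf≡N : ∀ ω → Sumℕ.sum (f ω) ≡ N ω) where

      -- On `Level K` the counts sum to exactly `K`, so `double-counting` with budget `K` charges
      -- precisely the `K`-th term of the expectation series.
      truncated-expectation : ∀ K →
        sum (λ i → ℙ (G i ∩ Below K)) ≤ partialSum (λ k → fromℕ k * ℙ (Level k)) K
      truncated-expectation zero = ≤-reflexive
        (trans (sum-cong-≋ λ i → ℙ-∩-Below-zero (mG i)) (trans (sum-const n 0#) (zeroʳ _)))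
      truncated-expectation (suc K) = begin
        sum (λ i → ℙ (G i ∩ Below (suc K)))
          ≈⟨ sum-cong-≋ (λ i → ℙ-∩-Below-suc (mG i) K) ⟩
        sum (λ i → ℙ (G i ∩ Below K) + ℙ (G i ∩ Level K))
          ≈⟨ ∑-distrib-+ (λ i → ℙ (G i ∩ Below K)) _ ⟩
        sum (λ i → ℙ (G i ∩ Below K)) + sum (λ i → ℙ (G i ∩ Level K))
          ≤⟨ +-mono-≤ (truncated-expectation K)
               (double-counting G mG f f≥1 K (N-measurable K) λ {ω} N≡K → ℕ.≤-reflexive (≡.trans (Σf≡N ω) N≡K)) ⟩
        partialSum (λ k → fromℕ k * ℙ (Level k)) K + fromℕ K * ℙ (Level K)
          ≈⟨ partialSum-suc (λ k → fromℕ k * ℙ (Level k)) K ⟨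
        partialSum (λ k → fromℕ k * ℙ (Level k)) (suc K) ∎
        where open ≤-Reasoning

      -- Truncating at `Below K` leaves only finite sums and avoids exchanging a sum with the
      -- series. It costs each event at most `1# - θ`, which the hypothesis on `G` has set aside.
      expectation-lower-bound : ∀ {e θ δ} → IsExpectation N e → θ < 1# →
        (∀ i → δ + 1# ≤ ℙ (G i) + θ) → fromℕ n * δ ≤ e
      expectation-lower-bound {e} {θ} {δ} isE θ<1 G-likely with Below-exhausts θ<1
      ... | K , θ≤ = begin
        fromℕ n * δ
          ≈⟨ sum-const n δ ⟨
        sum {n} (λ _ → δ)
          ≤⟨ sum-mono-≤ (λ i → +-cancelʳ-≤ 1# (≤-trans (≤-trans (G-likely i) (+-monoʳ-≤ _ θ≤)) (ℙ-∩-lower (mG i) (Below-measurable K)))) ⟩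
        sum (λ i → ℙ (G i ∩ Below K))
          ≤⟨ truncated-expectation K ⟩
        partialSum (λ k → fromℕ k * ℙ (Level k)) K
          ≤⟨ proj₁ isE _ (K , refl) ⟩
        e ∎
        where open ≤-Reasoning

-- Query trees and residual norms

module LowerBound (em : ExcludedMiddle 0ℓ) (ℝ : CompleteOrderedField) (power : RealPower ℝ) where
  open OrderedField em ℝ
  open RealPowerProperties em ℝ power
  open SignVectors em ℝ
  open RealPower power
  open Regression ℝ power using
    ( Matrix; QueryTree; output; query; result; queries; RandomizedQueryTree; RandomizedAlgorithm
    ; SolvesRegression; ExpectedQueriesAtMost; _·_; ‖_‖[_]; cost; IsApproxSolution)

  indicator : ∀ {n} → Fin n → Fin n → ℕ
  indicator i j = if does (i Fin.≟ j) then 1 else 0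

  sum-indicator : ∀ {n} (i : Fin n) → Sumℕ.sum (indicator i) ≡ 1
  sum-indicator {suc n} zero    = ≡.cong suc (Sumℕ.sum-replicate-zero n)
  sum-indicator {suc n} (suc i) = sum-indicator i

  -- Counted with multiplicity, because `queries` charges for repeated reads of the same entry.
  hits : ∀ {n d} → QueryTree n d → Vector Carrier n → Fin n → ℕ
  hits (output x)  b i = 0
  hits (query j k) b i = indicator j i ℕ.+ hits (k (b j)) b i

  sum-hits : ∀ {n d} (t : QueryTree n d) b → Sumℕ.sum (hits t b) ≡ queries t b
  sum-hits {n} (output x) b = Sumℕ.sum-replicate-zero n
  sum-hits (query j k) b = ≡.trans (Sumℕ.∑-distrib-+ (indicator j) _)
    (≡.cong₂ ℕ._+_ (sum-indicator j) (sum-hits (k (b j)) b))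

  -- Agreement is propositional because the continuation of a query need not respect `_≈_`. This is
  -- why `spike` is literally `0#` off its index.
  result-local : ∀ {n d} (t : QueryTree n d) {b b′ : Vector Carrier n} {i} → hits t b i ≡ 0 →
    (∀ j → i ≢ j → b′ j ≡ b j) → result t b′ ≡ result t b
  result-local (output x)  _ _ = ≡.refl
  result-local (query j k) {b} {b′} {i} unread agree with j Fin.≟ i
  -- Reading `i` itself would make `hits` a successor, against `unread`.
  ... | no j≢i rewrite agree j (j≢i ∘ ≡.sym) = result-local (k (b j)) unread agree

  ‖‖-nonNeg : ∀ {n p} (v : Vector Carrier n) → 0# < p → 0# ≤ ‖ v ‖[ p ]
  ‖‖-nonNeg v 0<p = ^-nonNeg (1/x-pos 0<p) (sum-nonNeg λ i → ^-nonNeg 0<p (∣x∣-nonNeg (v i)))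

  ‖v‖≤0⇒v≈0 : ∀ {n p} (v : Vector Carrier n) → 0# < p → ‖ v ‖[ p ] ≤ 0# → ∀ i → v i ≈ 0#
  ‖v‖≤0⇒v≈0 v 0<p ‖v‖≤0 i = ∣x∣≈0⇒x≈0 (^-reflects-≤0 (∣x∣-nonNeg (v i))
    (≤-trans (term≤sum powers≥0 i) (≤-reflexive (^-reflects-≤0 (sum-nonNeg powers≥0) ‖v‖≤0))))
    where powers≥0 = λ i → ^-nonNeg 0<p (∣x∣-nonNeg (v i))

  v≈0⇒‖v‖≈0 : ∀ {n p} (v : Vector Carrier n) → 0# < p → (∀ i → v i ≈ 0#) → ‖ v ‖[ p ] ≈ 0#
  v≈0⇒‖v‖≈0 {n} v 0<p v≈0 = ^-zero-base (1/x-pos 0<p)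
    (trans (sum-cong-≋ λ i → ^-zero-base 0<p (∣∣≈0 (v≈0 i))) (trans (sum-const n 0#) (zeroʳ _)))
    where
    ∣∣≈0 : ∀ {x} → x ≈ 0# → ∣ x ∣ ≈ 0#
    ∣∣≈0 {x} x≈0 with ∣∣-sel x
    ... | inj₁ ∣x∣≈x  = trans ∣x∣≈x x≈0
    ... | inj₂ ∣x∣≈-x = trans ∣x∣≈-x (trans (-‿cong x≈0) -0≈0)

  -- Phrased with a positive lower bound `x` of the entry, as `root-^` takes a positive base.
  ∣vᵢ∣≤‖v‖ : ∀ {n p x} (v : Vector Carrier n) → 0# < p → ∀ i → 0# < x → x ≤ ∣ v i ∣ → x ≤ ‖ v ‖[ p ]
  ∣vᵢ∣≤‖v‖ {n} {p} {x} v 0<p i 0<x x≤∣vᵢ∣ = begin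
    x                              ≈⟨ root-^ 0<p 0<x ⟨
    (x ^ p) ^ (1# / p)             ≤⟨ ^-monoˡ-≤ (1/x-pos 0<p) (proj₁ (^-pos p 0<x))
                                        (≤-trans (^-monoˡ-≤ 0<p (proj₁ 0<x) x≤∣vᵢ∣) (term≤sum (λ i → ^-nonNeg 0<p (∣x∣-nonNeg (v i))) i)) ⟩
    ‖ v ‖[ p ]                     ∎
    where open ≤-Reasoning

  -- A multiplicative guarantee leaves no slack when the optimum is `0#`, whatever `ρ` is.
  consistent-exact : ∀ {n d p ρ} {A : Matrix n d} {x̃ : Vector Carrier d} → 0# < p →
    IsApproxSolution p ρ A (λ _ → 0#) x̃ → ∀ j → (A · x̃) j ≈ 0#
  consistent-exact {n} {d} {p} {ρ} {A} {x̃} 0<p (μ , ((x , cost≈μ) , μ≤) , cost≤ρμ) j =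
    trans (sym (trans (+-congˡ -0≈0) (+-identityʳ _)))
      (‖v‖≤0⇒v≈0 (λ j → (A · x̃) j - 0#) 0<p (≤-trans cost≤ρμ (≤-reflexive (trans (*-congˡ μ≈0) (zeroʳ ρ)))) j)
    where
    μ≈0 : μ ≈ 0#
    μ≈0 = ≤-antisym
      (≤-trans (μ≤ (λ _ → 0#)) (≤-reflexive (v≈0⇒‖v‖≈0 (λ j → (A · (λ _ → 0#)) j - 0#) 0<p λ j → trans (+-cong (trans (sum-cong-≋ λ l → zeroʳ (A j l))
        (trans (sum-const d 0#) (zeroʳ _))) -0≈0) (+-identityʳ 0#))))
      (≤-trans (‖‖-nonNeg (λ j → (A · x) j - 0#) 0<p) (≤-reflexive cost≈μ))

  -- The hard instance and its constants

  module Construction (q p : Carrier) (2≤q : fromℕ 2 ≤ q) (q<p : q < p) where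

    0<2 : 0# < fromℕ 2
    0<2 = fromℕ-pos 2

    half : Carrier
    half = fromℕ 2 ⁻¹

    0<half : 0# < half
    0<half = ⁻¹-pos 0<2

    half+half≈1 : half + half ≈ 1#
    half+half≈1 = trans (solve 1 (λ w → w :+ w := con (2 , 0) :* w) refl half) (*-inverseʳ-pos 0<2)

    x/2+x/2≈x : ∀ x → x / fromℕ 2 + x / fromℕ 2 ≈ x
    x/2+x/2≈x x = trans (sym (distribˡ x half half)) (trans (*-congˡ half+half≈1) (*-identityʳ x))

    0<q : 0# < q
    0<q = <-≤-trans 0<2 2≤q

    0<p : 0# < p
    0<p = <-≤-trans 0<q (proj₁ q<p)

    h : Carrier
    h = p / fromℕ 2

    0<h : 0# < h
    0<h = *-pos 0<p 0<half

    -- Positive, so that evenPower K 0# vanishes even if archimedean returns 0.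
    K′ K : ℕ
    K′ = proj₁ (archimedean h)
    K = suc K′

    h≤K : h ≤ fromℕ K
    h≤K = ≤-trans (proj₂ (archimedean h)) (x≤y+x 0≤1)

    -- The two summands come from the two terms of `power≤even-power`: the constant one and the even
    -- moment.
    B : Carrier
    B = 1# + spread K ^ⁿ K

    0<B : 0# < B
    0<B = <-≤-trans 0<1 (x≤x+y (^ⁿ-nonNeg K (proj₁ (spread-pos K))))

    B^1/p = B ^ (1# / p)

    0<B^1/p : 0# < B^1/p
    0<B^1/p = ^-pos (1# / p) 0<B

    -- Cancels the constant in `cost-row` and leaves `half`: the admissible cost on a spike is at
    -- most D/2, while a blind output costs at least D.
    c : Carrier
    c = half * B^1/p ⁻¹

    0<c : 0# < c
    0<c = *-pos 0<half (⁻¹-pos 0<B^1/p)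

    -- Exponents of the error factor and of the cost of a row at its spike. Their sum being one
    -- makes the admissible cost linear in `D`, like the spike.
    α β : Carrier
    α = 1# / fromℕ 2 * (1# - q / p)
    β = (h + q / fromℕ 2) * (1# / p)

    α+β≈1 : α + β ≈ 1#
    α+β≈1 = begin
      1# * w * (1# - q * u) + (p * w + q * w) * (1# * u)
        ≈⟨ solve 4 (λ w u q p → con (1 , 0) :* w :* (con (1 , 0) :- q :* u) :+ (p :* w :+ q :* w) :* (con (1 , 0) :* u)
             := w :+ w :* (p :* u)) refl w u q p ⟩
      w + w * (p * u)  ≈⟨ +-congˡ (trans (*-congˡ (*-inverseʳ-pos 0<p)) (*-identityʳ w)) ⟩
      w + w            ≈⟨ half+half≈1 ⟩
      1#               ∎
      where
      open ≈-Reasoning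
      w = half
      u = p ⁻¹

    module _ (d : ℕ) .{{_ : NonZero d}} where

      D X : Carrier
      D = fromℕ d
      X = D ^ (q / fromℕ 2)

      0<D : 0# < D
      0<D = fromℕ-pos d

      1≤D : 1# ≤ D
      1≤D = ≤-trans (≤-reflexive (sym (+-identityʳ 1#))) (fromℕ-mono-≤ (ℕ.>-nonZero⁻¹ d))

      1≤X : 1# ≤ X
      1≤X = ≤-trans (≤-reflexive (sym (x^0≈1 0<D))) (^-monoʳ-≤ 1≤D (proj₁ (*-pos 0<q 0<half)))

      module _ {n} (code : SignCode K d n) (n≤X : fromℕ n ≤ X) where
        open SignCode code

        residual : Fin n → Vector Carrier n
        residual i j = ⟨ row j , row i ⟩ - spike D i j

        -- The factor `D ^ⁿ K` is carried along to keep the chain free of inverses and is cancelled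
        -- once.
        residual-power-sum : ∀ i → sum (λ j → ∣ residual i j ∣ ^ p) ≤ B * D ^ (h + q / fromℕ 2)
        residual-power-sum i = *-cancelʳ-≤ (^ⁿ-pos K 0<D) (begin
          sum (λ j → ∣ residual i j ∣ ^ p) * D ^ⁿ K
            ≈⟨ *-distribʳ-sum {n} (D ^ⁿ K) _ ⟩
          sum (λ j → ∣ residual i j ∣ ^ p * D ^ⁿ K)
            ≈⟨ sum-cong-≋ {n} (λ j → *-congʳ (^-cong refl (sym (x/2+x/2≈x p)))) ⟩
          sum (λ j → ∣ residual i j ∣ ^ (h + h) * D ^ⁿ K)
            ≤⟨ sum-mono-≤ (λ j → power≤even-power K 0<D 0<h h≤K (residual i j)) ⟩
          sum (λ j → D ^ h * (D ^ⁿ K + evenPower K (residual i j)))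
            ≈⟨ *-distribˡ-sum {n} (D ^ h) _ ⟨
          D ^ h * sum (λ j → D ^ⁿ K + evenPower K (residual i j))
            ≈⟨ *-congˡ (trans (∑-distrib-+ {n} (λ _ → D ^ⁿ K) _) (+-congʳ (sum-const n _))) ⟩
          D ^ h * (fromℕ n * D ^ⁿ K + sum (λ j → evenPower K (residual i j)))
            ≤⟨ *-monoʳ-≤ (proj₁ (^-pos h 0<D)) (+-monoʳ-≤ _ (residual-moment code i)) ⟩
          D ^ h * (fromℕ n * D ^ⁿ K + fromℕ n * (D * spread K) ^ⁿ K)
            ≈⟨ *-congˡ (+-congˡ (*-congˡ (^ⁿ-distrib-* D (spread K) K))) ⟩
          D ^ h * (fromℕ n * D ^ⁿ K + fromℕ n * (D ^ⁿ K * spread K ^ⁿ K))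
            ≈⟨ solve 4 (λ a n k l → a :* (n :* k :+ n :* (k :* l)) := (con (1 , 0) :+ l) :* (a :* n) :* k) refl (D ^ h) (fromℕ n) (D ^ⁿ K) (spread K ^ⁿ K) ⟩
          B * (D ^ h * fromℕ n) * D ^ⁿ K
            ≤⟨ *-monoˡ-≤ (^ⁿ-nonNeg K (proj₁ 0<D)) (*-monoʳ-≤ (proj₁ 0<B) (*-monoʳ-≤ (proj₁ (^-pos h 0<D)) n≤X)) ⟩
          B * (D ^ h * X) * D ^ⁿ K
            ≈⟨ *-congʳ (*-congˡ (^-distribˡ-+ h (q / fromℕ 2) 0<D)) ⟨
          B * D ^ (h + q / fromℕ 2) * D ^ⁿ K ∎)
          where open ≤-Reasoning

        cost-row : ∀ i → cost p row (spike D i) (row i) ≤ B^1/p * D ^ β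
        cost-row i = begin
          cost p row (spike D i) (row i)
            ≤⟨ ^-monoˡ-≤ (1/x-pos 0<p) (sum-nonNeg λ j → ^-nonNeg 0<p (∣x∣-nonNeg (residual i j))) (residual-power-sum i) ⟩
          (B * D ^ (h + q / fromℕ 2)) ^ (1# / p)
            ≈⟨ ^-distribʳ-* (1# / p) 0<B (^-pos _ 0<D) ⟩
          B^1/p * (D ^ (h + q / fromℕ 2)) ^ (1# / p)
            ≈⟨ *-congˡ (^-assocʳ _ _ 0<D) ⟩
          B^1/p * D ^ β ∎
          where open ≤-Reasoning

        blind-output-fails : ∀ i {x̃} → (∀ j → (row · x̃) j ≈ 0#) →
          ¬ IsApproxSolution p (c * D ^ α) row (spike D i) x̃
        blind-output-fails i {x̃} Ax̃≈0 (μ , (_ , μ≤) , cost≤ρμ) = <⇒≱ (*-pos 0<D 0<half)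
          (+-cancelʳ-≤ (D * half) (begin
            D * half + D * half            ≈⟨ x/2+x/2≈x D ⟩
            D                              ≤⟨ ∣vᵢ∣≤‖v‖ (λ j → (row · x̃) j - spike D i j) 0<p i 0<D D≤ ⟩
            cost p row (spike D i) x̃       ≤⟨ cost≤ρμ ⟩
            c * D ^ α * μ                  ≤⟨ *-monoʳ-≤ (proj₁ (*-pos 0<c (^-pos α 0<D))) (≤-trans (μ≤ (row i)) (cost-row i)) ⟩
            c * D ^ α * (B^1/p * D ^ β)    ≈⟨ solve 5 (λ w b⁻¹ a b e → w :* b⁻¹ :* a :* (b :* e) := a :* e :* (w :* (b :* b⁻¹))) refl half (B^1/p ⁻¹) (D ^ α) B^1/p (D ^ β) ⟩
            D ^ α * D ^ β * (half * (B^1/p * B^1/p ⁻¹))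
                                           ≈⟨ *-cong (trans (sym (^-distribˡ-+ α β 0<D)) (trans (^-cong refl α+β≈1) (^-identʳ 0<D)))
                                                (trans (*-congˡ (*-inverseʳ-pos 0<B^1/p)) (*-identityʳ half)) ⟩
            D * half                       ≈⟨ +-identityˡ _ ⟨
            0# + D * half                  ∎))
          where
          open ≤-Reasoning
          D≤ : D ≤ ∣ (row · x̃) i - spike D i i ∣
          D≤ = begin
            D                               ≈⟨ -‿involutive D ⟨
            - - D                           ≈⟨ -‿cong (trans (+-cong (Ax̃≈0 i) (-‿cong (reflexive (spike-diagonal D i)))) (+-identityˡ _)) ⟨
            - ((row · x̃) i - spike D i i)   ≤⟨ x≤y⊔x _ _ ⟩
            ∣ (row · x̃) i - spike D i i ∣   ∎

    -- `δ` is 1 - 3(1 - θ) = 0.97: failure on the zero input, failure on the spike and truncation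
    -- each cost `1# - θ`. The `half` in `κ` reflects that `n` may be as small as half of `X d`.
    θ δ κ : Carrier
    θ = fromℕ 99 / fromℕ 100
    δ = θ + θ + θ - 1# - 1#
    κ = δ * half

    θ*100≈99 : θ * fromℕ 100 ≈ fromℕ 99
    θ*100≈99 = trans (*-assoc _ _ _) (trans (*-congˡ (trans (*-comm _ _) (*-inverseʳ-pos (fromℕ-pos 100)))) (*-identityʳ _))

    0<δ : 0# < δ
    0<δ = ≰⇒> λ δ≤0 → <⇒≱ (fromℕ-pos 97) (begin
      fromℕ 97         ≈⟨ solve 0 (con (97 , 0) := con (99 , 0) :+ con (99 , 0) :+ con (99 , 0) :- con (100 , 0) :- con (100 , 0)) refl ⟩
      fromℕ 99 + fromℕ 99 + fromℕ 99 - fromℕ 100 - fromℕ 100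
                       ≈⟨ +-congʳ (+-congʳ (+-cong (+-cong θ*100≈99 θ*100≈99) θ*100≈99)) ⟨
      θ * fromℕ 100 + θ * fromℕ 100 + θ * fromℕ 100 - fromℕ 100 - fromℕ 100
                       ≈⟨ solve 2 (λ t h → t :* h :+ t :* h :+ t :* h :- h :- h := (t :+ t :+ t :- con (1 , 0) :- con (1 , 0)) :* h) refl θ (fromℕ 100) ⟩
      δ * fromℕ 100    ≤⟨ *-monoˡ-≤ (fromℕ-nonNeg 100) δ≤0 ⟩
      0# * fromℕ 100   ≈⟨ zeroˡ _ ⟩
      0#               ∎)
      where open ≤-Reasoning

    θ<1 : θ < 1#
    θ<1 = ≰⇒> λ 1≤θ → <⇒≱ 0<1 (+-cancelʳ-≤ (fromℕ 99) (begin
      fromℕ 100           ≈⟨ *-identityˡ _ ⟨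
      1# * fromℕ 100      ≤⟨ *-monoˡ-≤ (fromℕ-nonNeg 100) 1≤θ ⟩
      θ * fromℕ 100       ≈⟨ θ*100≈99 ⟩
      fromℕ 99            ≈⟨ +-identityˡ _ ⟨
      0# + fromℕ 99       ∎))
      where open ≤-Reasoning

    0<κ : 0# < κ
    0<κ = *-pos 0<δ 0<half

    module _ (d : ℕ) .{{_ : NonZero d}} (alg : RandomizedAlgorithm d)
             (solves : SolvesRegression p (c * fromℕ d ^ α) alg) where

      expectation-bound : ∀ {n} (code : SignCode K d n) → fromℕ n ≤ X d →
        let open RandomizedQueryTree (alg (SignCode.row code)) in
        ∀ {e} → IsExpectation (λ ω → queries (tree ω) (λ _ → 0#)) e → fromℕ n * δ ≤ e
      expectation-bound {n} code n≤X isE = expectation-lower-bound (queries-measurable zeros)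
        G (λ i → measurable-∩ m₀ (m i)) (λ ω → hits (tree ω) zeros) read
        (λ ω → sum-hits (tree ω) zeros) isE θ<1 likely
        where
        open SignCode code
        open RandomizedQueryTree (alg row)
        open Probability em ℝ power space
        zeros : Vector Carrier n
        zeros _ = 0#
        E₀ = proj₁ (solves row zeros)
        m₀ = proj₁ (proj₂ (solves row zeros))
        E : Fin n → Pred Ω 0ℓ
        E i = proj₁ (solves row (spike (fromℕ d) i))
        m : ∀ i → Measurable (E i)
        m i = proj₁ (proj₂ (solves row (spike (fromℕ d) i)))
        -- A measurable event inside the event that entry `i` is read: the same `ω`, hence the same
        -- tree, succeeds on both inputs.
        G : Fin n → Pred Ω 0ℓ
        G i = E₀ ∩ E i

        read : ∀ {ω} i → G i ω → 1 ℕ.≤ hits (tree ω) zeros i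
        read {ω} i (e₀ , eᵢ) with hits (tree ω) zeros i in unread
        ... | suc _ = ℕ.s≤s ℕ.z≤n
        ... | zero  = ⊥-elim (blind-output-fails d code n≤X i
          (consistent-exact 0<p (proj₁ (proj₂ (proj₂ (solves row zeros))) e₀))
          (≡.subst (IsApproxSolution p (c * fromℕ d ^ α) row (spike (fromℕ d) i))
            (result-local (tree ω) unread (λ j i≢j → spike-off-diagonal (fromℕ d) i≢j))
            (proj₁ (proj₂ (proj₂ (solves row (spike (fromℕ d) i)))) eᵢ)))

        likely : ∀ i → δ + 1# ≤ ℙ (G i) + θ
        likely i = +-cancelʳ-≤ 1# (begin
          δ + 1# + 1#                ≈⟨ solve 2 (λ t e → t :+ t :+ t :- e :- e :+ e :+ e := t :+ t :+ t) refl θ 1# ⟩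
          θ + θ + θ                  ≤⟨ +-monoˡ-≤ θ (+-mono-≤ (proj₂ (proj₂ (proj₂ (solves row zeros))))
                                          (proj₂ (proj₂ (proj₂ (solves row (spike (fromℕ d) i)))))) ⟩
          ℙ E₀ + ℙ (E i) + θ         ≤⟨ +-monoˡ-≤ θ (ℙ-∩-lower m₀ (m i)) ⟩
          ℙ (G i) + 1# + θ           ≈⟨ solve 3 (λ g e t → g :+ e :+ t := g :+ t :+ e) refl (ℙ (G i)) 1# θ ⟩
          ℙ (G i) + θ + 1#           ∎)
          where open ≤-Reasoning

      query-lower-bound : ∀ m → ExpectedQueriesAtMost m alg → κ * X d ≤ m
      query-lower-bound m bounded with exists-code K d (1≤X d)
      ... | n , code , n≤X , X≤2n with bounded (SignCode.row code) (λ _ → 0#)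
      ...   | e , isE , e≤m = begin
        κ * X d                              ≤⟨ *-monoʳ-≤ (proj₁ 0<κ) X≤2n ⟩
        κ * (fromℕ n + fromℕ n)              ≈⟨ solve 3 (λ δ w n → δ :* w :* (n :+ n) := n :* δ :* (w :+ w)) refl δ half (fromℕ n) ⟩
        fromℕ n * δ * (half + half)          ≈⟨ trans (*-congˡ half+half≈1) (*-identityʳ _) ⟩
        fromℕ n * δ                          ≤⟨ expectation-bound code n≤X isE ⟩
        e                                    ≤⟨ e≤m ⟩
        m                                    ∎
        where open ≤-Reasoning

theorem14p5 : ExcludedMiddle 0ℓ →
    (ℝ : CompleteOrderedField) (power : RealPower ℝ) →
    let open Regression ℝ power in
    ∀ (q p : Carrier) → fromℕ 2 ≤ q → q < p →
    ∃ λ c → 0# < c ×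
    ∃ λ κ → 0# < κ ×
    (∀ (d : ℕ) .{{_ : NonZero d}} (alg : RandomizedAlgorithm d) →
    SolvesRegression p (c * fromℕ d ^ (1# / fromℕ 2 * (1# - q / p))) alg →
    ∀ (m : Carrier) → ExpectedQueriesAtMost m alg →
    κ * fromℕ d ^ (q / fromℕ 2) ≤ m)
theorem14p5 em ℝ power q p 2≤q q<p = c , 0<c , κ , 0<κ , λ d alg solves → query-lower-bound d alg solves
  where open LowerBound.Construction em ℝ power q p 2≤q q<p
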